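{- Let $p>5$ be a prime. Then $$\sum_{k=0}^{[p/4]}\frac{\binom{4k}{2k}}{(-64)^k}\equiv\begin{cases}(-1)^{[\frac{p+5}{10}]}5^{[\frac p4]}\pmod p&\text{if }p\equiv1,3,7,9\pmod{20},\\ 2(-1)^{[\frac{p+5}{10}]}5^{\frac{p-3}4}\pmod p&\text{if }p\equiv11,19\pmod{20},\\ 0\pmod p&\text{if }p\equiv13,17\pmod{20}\end{cases}$$ and $$\sum_{k=0}^{[p/4]}\frac{\binom{4k}{2k}}{(-4)^k}\equiv\begin{cases}(-1)^{[\frac{p+5}{10}]}5^{[\frac p4]}\pmod p&\text{if }p\equiv1,9,11,19\pmod{20},\\ -2(-1)^{[\frac{p+5}{10}]}5^{\frac{p-3}4}\pmod p&\text{if }p\equiv3,7\pmod{20},\\ 0\pmod p&\text{if }p\equiv13,17\pmod{20}.\end{cases}$$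
   Context: $[x]$ is the greatest integer not exceeding $x$. -}

module Defs where

open import Data.Nat as ℕ using (ℕ; zero; suc)
open import Data.Nat.Combinatorics using (_C_)
open import Data.Integer as ℤ using (ℤ; +_; -[1+_])
open import Data.Integer.Divisibility as ℤD using ()
open import Data.Rational as ℚ using (ℚ; ↥_; ↧_; _+_; _*_; _-_; 0ℚ; 1ℚ)
open import Relation.Nullary using (¬_)
open import Data.Product using (_×_)

infixr 8 _^ℚ_
_^ℚ_ : ℚ → ℕ → ℚ
q ^ℚ zero = 1ℚ
q ^ℚ suc n = q * (q ^ℚ n)

Σ≤ : ℕ → (ℕ → ℚ) → ℚ
Σ≤ zero f = f 0
Σ≤ (suc n) f = Σ≤ n f + f (suc n)

ℕ→ℚ : ℕ → ℚ
ℕ→ℚ n = (+ n) ℚ./ 1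

ℤ→ℚ : ℤ → ℚ
ℤ→ℚ z = z ℚ./ 1

infix 4 _≡_[modℚ_]
_≡_[modℚ_] : ℚ → ℚ → ℕ → Set
a ≡ b [modℚ m ] = (¬ ((+ m) ℤD.∣ (↧ (a - b)))) × ((+ m) ℤD.∣ (↥ (a - b)))

{-# OPTIONS --safe #-}
-- Put n = (p-1)/2. Since C(2m,m) ≡ (-4)ᵐ C(n,m) (mod p), the two sums are congruent to the
-- rational parts of (1 + i/2)ⁿ and (1 + 2i)ⁿ. In ℤ[ζ], ζ a primitive 20th root of unity, both bases
-- are √5 (U/V)² with explicit U and V, so their n-th powers are (√5)ⁿ (Uᵖ/U) (V/Vᵖ). Modulo p the
-- Frobenius map sends U(ζ) to U(ζᵖ), which depends only on p modulo 20; each residue class is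
-- then settled by a computation in ℤ[ζ].
module Submission where

-- Let φ be the golden ratio. Since φ⁶ = 4φ³ + 1, one has (φ³ + i)² = 2φ³(2 + i); the base 1 + 2i =
-- i(2 - i) is treated alike, using 2i = (1 + i)². The unit φ is not a square in ℚ(ζ), but √5 φ = (ζ
-- + ζ⁻¹)² is, which brings in √5 and the 20th roots of unity. Division by U and Vᵖ is avoided, as
-- ℤ[ζ]/p may have zero divisors: multiplying by conjugates turns the divisor into 1600 = 2⁶5² or
-- 6400 = 2⁸5², which is cancelled only at the end, in ℤ modulo p > 5. Elements of ℤ[ζ]/p are kept
-- as unreduced integer coordinates and only their equality is taken modulo p, so each closed
-- identity is evaluated once, over ℤ, for a variable prime.

-- Quadratic ring extensions and the integers modulo `m`.

module Rings where
  open import Algebra.Bundles using (CommutativeRing)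
  open import Data.Nat using (ℕ)
  open import Data.Integer as ℤ using (ℤ; +_)
  import Data.Integer.Properties as ℤₚ
  open import Data.Integer.Tactic.RingSolver using (solve-∀)
  open import Data.Product using (_,_)
  open import Level using (0ℓ)
  open import Relation.Binary.Definitions using (DecidableEquality)
  open import Relation.Nullary.Decidable using (map′; _×-dec_)
  open import Relation.Binary.PropositionalEquality as ≡ using (_≡_)
  import Algebra.Solver.Ring.NaturalCoefficients.Default as Solver

  -- Without η, so that elements are not expanded into coordinates during conversion.
  record Pair {a} (A : Set a) : Set a where
    no-eta-equality
    pattern
    constructor ⟨_,_⟩
    field
      fst snd : A

  open Pair

  Pair-≟ : ∀ {a} {A : Set a} → DecidableEquality A → DecidableEquality (Pair A)
  Pair-≟ _≟_ ⟨ a , b ⟩ ⟨ c , d ⟩ =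
    map′ (λ { (≡.refl , ≡.refl) → ≡.refl }) (λ { ≡.refl → ≡.refl , ≡.refl }) ((a ≟ c) ×-dec (b ≟ d))

  -- R[t]/(t² - u t - v), with ⟨ a , b ⟩ standing for a + b t.
  module QuadraticExtension {a ℓ} (R : CommutativeRing a ℓ) (u v : CommutativeRing.Carrier R) where
    open CommutativeRing R hiding (ring)
    open Solver commutativeSemiring using (solve; _:=_; _:+_; _:*_; con)

    infixl 7 _⊗_
    infixl 6 _⊕_
    infix 4 _∼_

    _⊕_ _⊗_ : Pair Carrier → Pair Carrier → Pair Carrier
    ⟨ a , b ⟩ ⊕ ⟨ c , d ⟩ = ⟨ a + c , b + d ⟩
    ⟨ a , b ⟩ ⊗ ⟨ c , d ⟩ = ⟨ a * c + v * (b * d) , a * d + b * c + u * (b * d) ⟩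

    ⊖_ : Pair Carrier → Pair Carrier
    ⊖ ⟨ a , b ⟩ = ⟨ - a , - b ⟩

    ι : Carrier → Pair Carrier
    ι c = ⟨ c , 0# ⟩

    record _∼_ (x y : Pair Carrier) : Set ℓ where
      constructor _,_
      field
        fst-≈ : fst x ≈ fst y
        snd-≈ : snd x ≈ snd y

    open _∼_ public

    private
      ∼-trans : ∀ {x y z} → x ∼ y → y ∼ z → x ∼ z
      ∼-trans (e , f) (g , h) = trans e g , trans f h

      ⊕-cong : ∀ {x y z w} → x ∼ y → z ∼ w → x ⊕ z ∼ y ⊕ w
      ⊕-cong {⟨ _ , _ ⟩} {⟨ _ , _ ⟩} {⟨ _ , _ ⟩} {⟨ _ , _ ⟩} (e , f) (g , h) = +-cong e g , +-cong f h

      ⊕-assoc : ∀ x y z → (x ⊕ y) ⊕ z ∼ x ⊕ (y ⊕ z)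
      ⊕-assoc ⟨ _ , _ ⟩ ⟨ _ , _ ⟩ ⟨ _ , _ ⟩ = +-assoc _ _ _ , +-assoc _ _ _

      ⊕-comm : ∀ x y → x ⊕ y ∼ y ⊕ x
      ⊕-comm ⟨ _ , _ ⟩ ⟨ _ , _ ⟩ = +-comm _ _ , +-comm _ _

      zero-⊕ : ∀ x → ι 0# ⊕ x ∼ x
      zero-⊕ ⟨ _ , _ ⟩ = +-identityˡ _ , +-identityˡ _

      ⊖-⊕ : ∀ x → ⊖ x ⊕ x ∼ ι 0#
      ⊖-⊕ ⟨ _ , _ ⟩ = -‿inverseˡ _ , -‿inverseˡ _

      ⊖-cong : ∀ {x y} → x ∼ y → ⊖ x ∼ ⊖ y
      ⊖-cong {⟨ _ , _ ⟩} {⟨ _ , _ ⟩} (e , f) = -‿cong e , -‿cong f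

      ⊗-cong : ∀ {x y z w} → x ∼ y → z ∼ w → x ⊗ z ∼ y ⊗ w
      ⊗-cong {⟨ _ , _ ⟩} {⟨ _ , _ ⟩} {⟨ _ , _ ⟩} {⟨ _ , _ ⟩} (e , f) (g , h) =
        +-cong (*-cong e g) (*-congˡ (*-cong f h)) ,
        +-cong (+-cong (*-cong e h) (*-cong f g)) (*-congˡ (*-cong f h))

      one-⊗ : ∀ x → ι 1# ⊗ x ∼ x
      one-⊗ ⟨ a , b ⟩ =
        solve 3 (λ a b v → con 1 :* a :+ v :* (con 0 :* b) := a) refl a b v ,
        solve 3 (λ a b u → con 1 :* b :+ con 0 :* a :+ u :* (con 0 :* b) := b) refl a b u

      ⊗-comm : ∀ x y → x ⊗ y ∼ y ⊗ x
      ⊗-comm ⟨ a , b ⟩ ⟨ c , d ⟩ =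
        solve 5 (λ a b c d v → a :* c :+ v :* (b :* d) := c :* a :+ v :* (d :* b)) refl a b c d v ,
        solve 5 (λ a b c d u → a :* d :+ b :* c :+ u :* (b :* d) := c :* b :+ d :* a :+ u :* (d :* b)) refl a b c d u

      ⊗-assoc : ∀ x y z → (x ⊗ y) ⊗ z ∼ x ⊗ (y ⊗ z)
      ⊗-assoc ⟨ a , b ⟩ ⟨ c , d ⟩ ⟨ e , f ⟩ =
        solve 8 (λ a b c d e f u v →
          (a :* c :+ v :* (b :* d)) :* e :+ v :* ((a :* d :+ b :* c :+ u :* (b :* d)) :* f)
          := a :* (c :* e :+ v :* (d :* f)) :+ v :* (b :* (c :* f :+ d :* e :+ u :* (d :* f))))
          refl a b c d e f u v ,
        solve 8 (λ a b c d e f u v →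
          (a :* c :+ v :* (b :* d)) :* f :+ (a :* d :+ b :* c :+ u :* (b :* d)) :* e
            :+ u :* ((a :* d :+ b :* c :+ u :* (b :* d)) :* f)
          := a :* (c :* f :+ d :* e :+ u :* (d :* f)) :+ b :* (c :* e :+ v :* (d :* f))
            :+ u :* (b :* (c :* f :+ d :* e :+ u :* (d :* f))))
          refl a b c d e f u v

      ⊗-distribˡ : ∀ x y z → x ⊗ (y ⊕ z) ∼ (x ⊗ y) ⊕ (x ⊗ z)
      ⊗-distribˡ ⟨ a , b ⟩ ⟨ c , d ⟩ ⟨ e , f ⟩ =
        solve 7 (λ a b c d e f v →
          a :* (c :+ e) :+ v :* (b :* (d :+ f))
          := (a :* c :+ v :* (b :* d)) :+ (a :* e :+ v :* (b :* f))) refl a b c d e f v ,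
        solve 7 (λ a b c d e f u →
          a :* (d :+ f) :+ b :* (c :+ e) :+ u :* (b :* (d :+ f))
          := (a :* d :+ b :* c :+ u :* (b :* d)) :+ (a :* f :+ b :* e :+ u :* (b :* f))) refl a b c d e f u

    ring : CommutativeRing a ℓ
    ring = record
      { _≈_ = _∼_
      ; _+_ = _⊕_
      ; _*_ = _⊗_
      ; -_ = ⊖_
      ; 0# = ι 0#
      ; 1# = ι 1#
      ; isCommutativeRing = record
        { isRing = record
          { +-isAbelianGroup = record
            { isGroup = record
              { isMonoid = record
                { isSemigroup = record
                  { isMagma = record
                    { isEquivalence = record
                      { refl = refl , refl
                      ; sym = λ (e , f) → sym e , sym f
                      ; trans = ∼-trans
                      }
                    ; ∙-cong = ⊕-cong
                    }
                  ; assoc = ⊕-assoc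
                  }
                ; identity = zero-⊕ , λ x → ∼-trans (⊕-comm x (ι 0#)) (zero-⊕ x)
                }
              ; inverse = ⊖-⊕ , λ x → ∼-trans (⊕-comm x (⊖ x)) (⊖-⊕ x)
              ; ⁻¹-cong = ⊖-cong
              }
            ; comm = ⊕-comm
            }
          ; *-cong = ⊗-cong
          ; *-assoc = ⊗-assoc
          ; *-identity = one-⊗ , λ x → ∼-trans (⊗-comm x (ι 1#)) (one-⊗ x)
          ; distrib = ⊗-distribˡ , λ z x y →
              ∼-trans (⊗-comm (x ⊕ y) z)
                (∼-trans (⊗-distribˡ z x y) (⊕-cong (⊗-comm z x) (⊗-comm z y)))
          }
        ; *-comm = ⊗-comm
        }
      }

    ι-cong : ∀ {x y} → x ≈ y → ι x ∼ ι y
    ι-cong e = e , refl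

    ι-+ : ∀ x y → ι (x + y) ∼ ι x ⊕ ι y
    ι-+ x y = refl , sym (+-identityˡ 0#)

    ι-* : ∀ x y → ι (x * y) ∼ ι x ⊗ ι y
    ι-* x y =
      solve 3 (λ x y v → x :* y := x :* y :+ v :* (con 0 :* con 0)) refl x y v ,
      solve 3 (λ x y u → con 0 := x :* con 0 :+ con 0 :* y :+ u :* (con 0 :* con 0)) refl x y u

    fst-ι+ : ∀ c x → fst (ι c ⊕ x) ≈ c + fst x
    fst-ι+ c ⟨ a , b ⟩ = refl

    fst-ι* : ∀ c x → fst (ι c ⊗ x) ≈ c * fst x
    fst-ι* c ⟨ a , b ⟩ = solve 4 (λ c a b v → c :* a :+ v :* (con 0 :* b) := c :* a) refl c a b v

  module Modular (m : ℕ) where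

    infix 4 _≋_
    -- Keeping the quotient as a witness turns each congruence law into a polynomial identity over
    -- ℤ.
    record _≋_ (x y : ℤ) : Set where
      constructor cong-mod
      field
        quotient : ℤ
        equality : x ≡ y ℤ.+ quotient ℤ.* + m

    ≋-reflexive : ∀ {x y} → x ≡ y → x ≋ y
    ≋-reflexive {x} ≡.refl = cong-mod (+ 0) (≡.sym (ℤₚ.+-identityʳ x))

    ≋-sym : ∀ {x y} → x ≋ y → y ≋ x
    ≋-sym {y = y} (cong-mod q ≡.refl) = cong-mod (ℤ.- q) (lemma y q (+ m))
      where
      lemma : ∀ y q m → y ≡ (y ℤ.+ q ℤ.* m) ℤ.+ ℤ.- q ℤ.* m
      lemma = solve-∀

    ≋-trans : ∀ {x y z} → x ≋ y → y ≋ z → x ≋ z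
    ≋-trans {z = z} (cong-mod q ≡.refl) (cong-mod r ≡.refl) = cong-mod (r ℤ.+ q) (lemma z q r (+ m))
      where
      lemma : ∀ z q r m → (z ℤ.+ r ℤ.* m) ℤ.+ q ℤ.* m ≡ z ℤ.+ (r ℤ.+ q) ℤ.* m
      lemma = solve-∀

    ≋-+-cong : ∀ {x y z w} → x ≋ y → z ≋ w → (x ℤ.+ z) ≋ (y ℤ.+ w)
    ≋-+-cong {y = y} {w = w} (cong-mod q ≡.refl) (cong-mod r ≡.refl) = cong-mod (q ℤ.+ r) (lemma y w q r (+ m))
      where
      lemma : ∀ y w q r m → (y ℤ.+ q ℤ.* m) ℤ.+ (w ℤ.+ r ℤ.* m) ≡ (y ℤ.+ w) ℤ.+ (q ℤ.+ r) ℤ.* m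
      lemma = solve-∀

    ≋-*-cong : ∀ {x y z w} → x ≋ y → z ≋ w → (x ℤ.* z) ≋ (y ℤ.* w)
    ≋-*-cong {y = y} {w = w} (cong-mod q ≡.refl) (cong-mod r ≡.refl) =
      cong-mod (y ℤ.* r ℤ.+ q ℤ.* w ℤ.+ q ℤ.* r ℤ.* + m) (lemma y w q r (+ m))
      where
      lemma : ∀ y w q r m → (y ℤ.+ q ℤ.* m) ℤ.* (w ℤ.+ r ℤ.* m)
        ≡ y ℤ.* w ℤ.+ (y ℤ.* r ℤ.+ q ℤ.* w ℤ.+ q ℤ.* r ℤ.* m) ℤ.* m
      lemma = solve-∀

    ≋-neg-cong : ∀ {x y} → x ≋ y → (ℤ.- x) ≋ (ℤ.- y)
    ≋-neg-cong {y = y} (cong-mod q ≡.refl) = cong-mod (ℤ.- q) (lemma y q (+ m))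
      where
      lemma : ∀ y q m → ℤ.- (y ℤ.+ q ℤ.* m) ≡ ℤ.- y ℤ.+ ℤ.- q ℤ.* m
      lemma = solve-∀

    -- The modulus enters only through the equality. Closed expressions therefore evaluate to
    -- integers even when `m` is a variable.
    ℤ/m : CommutativeRing 0ℓ 0ℓ
    ℤ/m = record
      { Carrier = ℤ
      ; _≈_ = _≋_
      ; _+_ = ℤ._+_
      ; _*_ = ℤ._*_
      ; -_ = ℤ.-_
      ; 0# = + 0
      ; 1# = + 1
      ; isCommutativeRing = record
        { isRing = record
          { +-isAbelianGroup = record
            { isGroup = record
              { isMonoid = record
                { isSemigroup = record
                  { isMagma = record
                    { isEquivalence = record { refl = ≋-reflexive ≡.refl ; sym = ≋-sym ; trans = ≋-trans }
                    ; ∙-cong = ≋-+-cong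
                    }
                  ; assoc = λ x y z → ≋-reflexive (ℤₚ.+-assoc x y z)
                  }
                ; identity = (λ x → ≋-reflexive (ℤₚ.+-identityˡ x)) , (λ x → ≋-reflexive (ℤₚ.+-identityʳ x))
                }
              ; inverse = (λ x → ≋-reflexive (ℤₚ.+-inverseˡ x)) , (λ x → ≋-reflexive (ℤₚ.+-inverseʳ x))
              ; ⁻¹-cong = ≋-neg-cong
              }
            ; comm = λ x y → ≋-reflexive (ℤₚ.+-comm x y)
            }
          ; *-cong = ≋-*-cong
          ; *-assoc = λ x y z → ≋-reflexive (ℤₚ.*-assoc x y z)
          ; *-identity = (λ x → ≋-reflexive (ℤₚ.*-identityˡ x)) , (λ x → ≋-reflexive (ℤₚ.*-identityʳ x))
          ; distrib = (λ x y z → ≋-reflexive (ℤₚ.*-distribˡ-+ x y z)) , (λ x y z → ≋-reflexive (ℤₚ.*-distribʳ-+ x y z))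
          }
        ; *-comm = λ x y → ≋-reflexive (ℤₚ.*-comm x y)
        }
      }

-- Binomial coefficients and the Frobenius map.

module Binomials where
  open import Algebra.Bundles using (CommutativeRing)
  open import Data.Fin using (zero; suc; toℕ; fromℕ)
  open import Data.Fin.Properties using (toℕ-inject₁; toℕ-fromℕ; toℕ<n)
  open import Data.Nat using (zero; suc; _+_; _*_; _∸_; _<_; s≤s)
  open import Data.Nat.Combinatorics using (_C_; nCk+nC[k+1]≡[n+1]C[k+1]; nC1≡n; nCn≡1; nCk≡nC[n∸k])
  open import Data.Nat.Divisibility using (_∣_; divides; ∣⇒≤; m∣m*n)
  open import Data.Nat.Primality using (Prime; euclidsLemma)
  import Data.Nat.Properties as ℕₚ
  open import Data.Nat.Solver using (module +-*-Solver)
  open import Data.Sum using (inj₁; inj₂)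
  open import Data.Vec.Functional using (init; last)
  open import Function using (_∘_)
  open import Relation.Nullary using (contradiction)
  open import Relation.Binary.PropositionalEquality as ≡ using (_≡_; cong; cong₂; module ≡-Reasoning)
  import Algebra.Solver.Ring.NaturalCoefficients.Default as Solver

  -- Moving the subtraction in the ratio formula (k + 1) C(n, k + 1) = (n - k) C(n, k) to the left
  -- keeps it valid in ℕ, even for k > n.
  C-succ-lower : ∀ n k → suc k * (n C suc k) + k * (n C k) ≡ n * (n C k)
  C-succ-lower zero zero = ≡.refl
  C-succ-lower zero (suc k) = cong₂ _+_ (ℕₚ.*-zeroʳ (suc (suc k))) (ℕₚ.*-zeroʳ (suc k))
  C-succ-lower (suc n) zero = begin
    1 * (suc n C 1) + 0 ≡⟨ cong (λ x → 1 * x + 0) (nC1≡n (suc n)) ⟩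
    1 * suc n + 0       ≡⟨ ℕₚ.+-identityʳ _ ⟩
    1 * suc n           ≡⟨ ℕₚ.*-comm 1 (suc n) ⟩
    suc n * 1           ∎
    where open ≡-Reasoning
  C-succ-lower (suc n) (suc k) = begin
    suc (suc k) * (suc n C suc (suc k)) + suc k * (suc n C suc k)
      ≡⟨ cong₂ (λ x y → suc (suc k) * x + suc k * y) (nCk+nC[k+1]≡[n+1]C[k+1] n (suc k)) (nCk+nC[k+1]≡[n+1]C[k+1] n k) ⟨
    suc (suc k) * (b + c) + suc k * (a + b)
      ≡⟨ solve 4 (λ k a b c → (con 2 :+ k) :* (b :+ c) :+ (con 1 :+ k) :* (a :+ b)
                    := ((con 2 :+ k) :* c :+ (con 1 :+ k) :* b) :+ ((con 1 :+ k) :* b :+ k :* a) :+ (a :+ b)) ≡.refl k a b c ⟩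
    (suc (suc k) * c + suc k * b) + (suc k * b + k * a) + (a + b)
      ≡⟨ cong₂ (λ x y → x + y + (a + b)) (C-succ-lower n (suc k)) (C-succ-lower n k) ⟩
    n * b + n * a + (a + b)
      ≡⟨ solve 3 (λ n a b → n :* b :+ n :* a :+ (a :+ b) := (con 1 :+ n) :* (a :+ b)) ≡.refl n a b ⟩
    suc n * (a + b)
      ≡⟨ cong (suc n *_) (nCk+nC[k+1]≡[n+1]C[k+1] n k) ⟩
    suc n * (suc n C suc k) ∎
    where
    open ≡-Reasoning
    open +-*-Solver
    a = n C k
    b = n C suc k
    c = n C suc (suc k)

  C-absorb : ∀ n k → suc k * (suc n C suc k) ≡ suc n * (n C k)
  C-absorb n k = begin
    suc k * (suc n C suc k)                   ≡⟨ cong (suc k *_) (nCk+nC[k+1]≡[n+1]C[k+1] n k) ⟨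
    suc k * (n C k + n C suc k)               ≡⟨ solve 3 (λ k a b → (con 1 :+ k) :* (a :+ b) := a :+ ((con 1 :+ k) :* b :+ k :* a)) ≡.refl k (n C k) (n C suc k) ⟩
    n C k + (suc k * (n C suc k) + k * (n C k)) ≡⟨ cong (n C k +_) (C-succ-lower n k) ⟩
    suc n * (n C k)                           ∎
    where
    open ≡-Reasoning
    open +-*-Solver

  -- Absorption is applied twice; in between, the symmetry C(2m + 1, m) = C(2m + 1, m + 1) prepares
  -- the second application.
  central-succ : ∀ m → suc m * ((2 * suc m) C suc m) ≡ 2 * (suc (2 * m) * ((2 * m) C m))
  central-succ m = begin
    suc m * ((2 * suc m) C suc m)          ≡⟨ cong (λ x → suc m * (x C suc m)) (ℕₚ.*-suc 2 m) ⟩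
    suc m * (suc (suc (2 * m)) C suc m)    ≡⟨ C-absorb (suc (2 * m)) m ⟩
    suc (suc (2 * m)) * (suc (2 * m) C m)  ≡⟨ cong (suc (suc (2 * m)) *_) symmetric ⟩
    suc (suc (2 * m)) * (suc (2 * m) C suc m)
      ≡⟨ solve 2 (λ m x → (con 2 :+ con 2 :* m) :* x := con 2 :* ((con 1 :+ m) :* x)) ≡.refl m (suc (2 * m) C suc m) ⟩
    2 * (suc m * (suc (2 * m) C suc m))    ≡⟨ cong (2 *_) (C-absorb (2 * m) m) ⟩
    2 * (suc (2 * m) * ((2 * m) C m))      ∎
    where
    open ≡-Reasoning
    open +-*-Solver
    symmetric : suc (2 * m) C m ≡ suc (2 * m) C suc m
    symmetric = ≡.trans (nCk≡nC[n∸k] (ℕₚ.m≤n⇒m≤1+n (ℕₚ.m≤m+n m (m + 0))))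
      (cong (suc (2 * m) C_) (begin
        suc (2 * m) ∸ m     ≡⟨ cong (_∸ m) (solve 1 (λ m → con 1 :+ con 2 :* m := m :+ (con 1 :+ m)) ≡.refl m) ⟩
        (m + suc m) ∸ m     ≡⟨ ℕₚ.m+n∸m≡n m (suc m) ⟩
        suc m               ∎))

  -- By absorption the prime p = n + 1 divides (k + 1) C(p, k + 1), and it cannot divide k + 1,
  -- which is positive and below p.
  prime∣C : ∀ {n} k → Prime (suc n) → k < n → suc n ∣ (suc n C suc k)
  prime∣C {n} k pr k<n with euclidsLemma (suc k) (suc n C suc k) pr (≡.subst (suc n ∣_) (≡.sym (C-absorb n k)) (m∣m*n (n C k)))
  ... | inj₁ d = contradiction (∣⇒≤ d) (ℕₚ.<⇒≱ (s≤s k<n))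
  ... | inj₂ d = d

  module Frobenius {a ℓ} (R : CommutativeRing a ℓ) where
    open CommutativeRing R hiding (_+_; _*_; zero)
    open CommutativeRing R using () renaming (_+_ to _⊕_; _*_ to _⊗_)
    open import Algebra.Properties.CommutativeSemiring.Exp commutativeSemiring
    open import Algebra.Properties.CommutativeSemiring.Binomial commutativeSemiring
    open import Algebra.Properties.Semiring.Mult semiring
    open import Algebra.Properties.Semiring.Sum semiring
    open import Relation.Binary.Reasoning.Setoid setoid

    multiple≈0 : ∀ {p} → p × 1# ≈ 0# → ∀ {n} x → p ∣ n → n × x ≈ 0#
    multiple≈0 {p} p≈0 x (divides q ≡.refl) = begin
      (q * p) × x          ≈⟨ ×-assocˡ x q p ⟨
      q × (p × x)          ≈⟨ ×-congʳ q (×-congʳ p (*-identityˡ x)) ⟨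
      q × (p × (1# ⊗ x))   ≈⟨ ×-congʳ q (×-assoc-* p 1# x) ⟨
      q × ((p × 1#) ⊗ x)   ≈⟨ ×-congʳ q (*-congʳ p≈0) ⟩
      q × (0# ⊗ x)         ≈⟨ ×-congʳ q (zeroˡ x) ⟩
      q × 0#               ≈⟨ ×-zero q ⟩
      0#                   ∎
      where
      ×-zero : ∀ q → q × 0# ≈ 0#
      ×-zero zero = refl
      ×-zero (suc q) = trans (+-identityˡ _) (×-zero q)

    frobenius-+ : ∀ {p} → Prime p → p × 1# ≈ 0# → ∀ x y → (x ⊕ y) ^ p ≈ x ^ p ⊕ y ^ p
    frobenius-+ {suc n} p-prime p≈0 x y = begin
      (x ⊕ y) ^ suc n                                ≈⟨ theorem (suc n) x y ⟩
      term zero ⊕ sum {suc n} (term ∘ suc)           ≈⟨ +-congˡ (sum-init-last (term ∘ suc)) ⟩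
      term zero ⊕ (sum (init (term ∘ suc)) ⊕ last (term ∘ suc))
        -- The n = p - 1 middle terms have coefficients divisible by p. The exponent of `x`
        -- increases along the sum, so the first term is yᵖ and the last xᵖ.
        ≈⟨ +-cong first (+-cong (trans (sum-cong-≋ middle) (sum-replicate-zero n)) final) ⟩
      y ^ suc n ⊕ (0# ⊕ x ^ suc n)                   ≈⟨ +-congˡ (+-identityˡ _) ⟩
      y ^ suc n ⊕ x ^ suc n                          ≈⟨ +-comm _ _ ⟩
      x ^ suc n ⊕ y ^ suc n                          ∎
      where
      term = binomialTerm x y (suc n)

      first : term zero ≈ y ^ suc n
      first = trans (×-homo-1 _) (*-identityˡ _)

      middle : ∀ k → init (term ∘ suc) k ≈ 0#
      middle k = multiple≈0 p≈0 _ (prime∣C _ p-prime (≡.subst (_< n) (≡.sym (toℕ-inject₁ k)) (toℕ<n k)))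

      final : last (term ∘ suc) ≈ x ^ suc n
      final = begin
        (suc n C suc (toℕ (fromℕ n))) × (x ^ suc (toℕ (fromℕ n)) ⊗ y ^ (n ∸ toℕ (fromℕ n)))
          ≡⟨ cong (λ j → (suc n C suc j) × (x ^ suc j ⊗ y ^ (n ∸ j))) (toℕ-fromℕ n) ⟩
        (suc n C suc n) × (x ^ suc n ⊗ y ^ (n ∸ n))
          ≡⟨ cong₂ (λ c e → c × (x ^ suc n ⊗ y ^ e)) (nCn≡1 (suc n)) (ℕₚ.n∸n≡0 n) ⟩
        1 × (x ^ suc n ⊗ 1#)      ≈⟨ ×-homo-1 _ ⟩
        x ^ suc n ⊗ 1#            ≈⟨ *-identityʳ _ ⟩
        x ^ suc n                 ∎

    -- The n-th power of the hypothesis contains x²ⁿ and y²ⁿ; multiplying both sides by x y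
    -- completes them to p-th powers, ready for Frobenius, without dividing by x or y.
    half-power : ∀ {t x y w p} n → p ≡ suc (2 * n) → t ⊗ (x ⊗ x) ≈ (y ⊗ y) ⊗ w →
      t ^ n ⊗ (x ^ p ⊗ y) ≈ (y ^ p ⊗ w ^ n) ⊗ x
    half-power {t} {x} {y} {w} n ≡.refl eq = begin
      t ^ n ⊗ ((x ⊗ x ^ (2 * n)) ⊗ y)          ≈⟨ *-congˡ (*-congʳ (*-congˡ (^-square x))) ⟩
      t ^ n ⊗ ((x ⊗ (x ⊗ x) ^ n) ⊗ y)          ≈⟨ solve 4 (λ t x y u → t :* ((x :* u) :* y) := (t :* u) :* (x :* y)) refl (t ^ n) x y _ ⟩
      (t ^ n ⊗ (x ⊗ x) ^ n) ⊗ (x ⊗ y)          ≈⟨ *-congʳ (^-distrib-* t (x ⊗ x) n) ⟨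
      (t ⊗ (x ⊗ x)) ^ n ⊗ (x ⊗ y)              ≈⟨ *-congʳ (^-congˡ n eq) ⟩
      ((y ⊗ y) ⊗ w) ^ n ⊗ (x ⊗ y)              ≈⟨ *-congʳ (^-distrib-* (y ⊗ y) w n) ⟩
      ((y ⊗ y) ^ n ⊗ w ^ n) ⊗ (x ⊗ y)          ≈⟨ *-congʳ (*-congʳ (^-square y)) ⟨
      (y ^ (2 * n) ⊗ w ^ n) ⊗ (x ⊗ y)          ≈⟨ solve 4 (λ u w x y → (u :* w) :* (x :* y) := ((y :* u) :* w) :* x) refl _ (w ^ n) x y ⟩
      ((y ⊗ y ^ (2 * n)) ⊗ w ^ n) ⊗ x          ∎
      where
      open Solver commutativeSemiring using (solve; _:=_; _:*_)
      ^-square : ∀ x → x ^ (2 * n) ≈ (x ⊗ x) ^ n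
      ^-square x = trans (sym (^-assocʳ x 2 n)) (^-congˡ n (*-congˡ (*-identityʳ x)))

-- Powers of 1 + i/2 and 1 + 2i in cyclotomic rings.

module CyclotomicPowers where
  open Rings
  open Pair
  open Binomials
  open import Algebra.Bundles using (CommutativeRing)
  open import Data.Bool using (true)
  open import Data.Nat as ℕ using (ℕ; zero; suc)
  import Data.Nat.Properties as ℕₚ
  open import Data.Nat.Primality using (Prime)
  open import Data.Nat.Solver using (module +-*-Solver)
  open import Data.Integer as ℤ using (ℤ; +_; -[1+_])
  import Data.Integer.Properties as ℤₚ
  open import Data.Integer.Tactic.RingSolver using (solve-∀)
  open import Level using (0ℓ)
  open import Relation.Binary.Definitions using (DecidableEquality)
  open import Relation.Nullary using (does; yes)
  open import Relation.Binary.PropositionalEquality as ≡ using (_≡_)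
  import Algebra.Solver.Ring.NaturalCoefficients.Default as Solver

  -- A syntax, so that f(x)ᵖ = f(xᵖ) can be proved by induction on f. Generated by 1 and the
  -- variable, it has coefficients in ℕ; inverses and signs are expressed by ζ²⁰ = 1, for instance
  -- -i as ζ¹⁵.
  data Poly : Set where
    one var : Poly
    _⊞_ _⊠_ : Poly → Poly → Poly

  infixl 7 _⊠_
  infixl 6 _⊞_

  mono : ℕ → Poly
  mono zero = one
  mono (suc n) = var ⊠ mono n

  2l+20q : ∀ l q → 2 ℕ.* l ℕ.+ q ℕ.* 20 ≡ 2 ℕ.* (l ℕ.+ q ℕ.* 10)
  2l+20q = solve 2 (λ l q → con 2 :* l :+ q :* con 20 := con 2 :* (l :+ q :* con 10)) ≡.refl
    where open +-*-Solver

  -- (1 + √d)ⁿ = even d n + odd d n √d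
  even odd : ℤ → ℕ → ℤ
  even d zero = + 1
  even d (suc n) = even d n ℤ.+ d ℤ.* odd d n
  odd d zero = + 0
  odd d (suc n) = even d n ℤ.+ odd d n

  module Evaluation {a ℓ} (R : CommutativeRing a ℓ) where
    open CommutativeRing R hiding (zero)
    open import Algebra.Properties.CommutativeSemiring.Exp commutativeSemiring
    open import Algebra.Properties.Semiring.Mult semiring using () renaming (_×_ to _·_)

    ⟦_⟧ : Poly → Carrier → Carrier
    ⟦ one ⟧ x = 1#
    ⟦ var ⟧ x = x
    ⟦ f ⊞ g ⟧ x = ⟦ f ⟧ x + ⟦ g ⟧ x
    ⟦ f ⊠ g ⟧ x = ⟦ f ⟧ x * ⟦ g ⟧ x

    ⟦⟧-cong : ∀ f {x y} → x ≈ y → ⟦ f ⟧ x ≈ ⟦ f ⟧ y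
    ⟦⟧-cong one e = refl
    ⟦⟧-cong var e = e
    ⟦⟧-cong (f ⊞ g) e = +-cong (⟦⟧-cong f e) (⟦⟧-cong g e)
    ⟦⟧-cong (f ⊠ g) e = *-cong (⟦⟧-cong f e) (⟦⟧-cong g e)

    1^n≈1 : ∀ n → 1# ^ n ≈ 1#
    1^n≈1 zero = refl
    1^n≈1 (suc n) = trans (*-identityˡ _) (1^n≈1 n)

    ⟦⟧-frobenius : ∀ {p} → Prime p → p · 1# ≈ 0# → ∀ f x → ⟦ f ⟧ x ^ p ≈ ⟦ f ⟧ (x ^ p)
    ⟦⟧-frobenius {p} p-prime p≈0 = go
      where
      go : ∀ f x → ⟦ f ⟧ x ^ p ≈ ⟦ f ⟧ (x ^ p)
      go one x = 1^n≈1 p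
      go var x = refl
      go (f ⊞ g) x = trans (Frobenius.frobenius-+ R p-prime p≈0 _ _) (+-cong (go f x) (go g x))
      go (f ⊠ g) x = trans (^-distrib-* _ _ p) (*-cong (go f x) (go g x))

    open import Relation.Binary.Reasoning.Setoid setoid
    open Solver commutativeSemiring using (solve; _:=_; _:+_; _:*_; con)

    ^-period : ∀ {x y} a b q → x ^ b ≈ y → x ^ (a ℕ.+ q ℕ.* b) ≈ x ^ a * y ^ q
    ^-period {x} {y} a b q e = begin
      x ^ (a ℕ.+ q ℕ.* b)    ≈⟨ ^-homo-* x a (q ℕ.* b) ⟩
      x ^ a * x ^ (q ℕ.* b)  ≡⟨ ≡.cong (λ k → x ^ a * x ^ k) (ℕₚ.*-comm q b) ⟩
      x ^ a * x ^ (b ℕ.* q)  ≈⟨ *-congˡ (^-assocʳ x b q) ⟨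
      x ^ a * (x ^ b) ^ q    ≈⟨ *-congˡ (^-congˡ q e) ⟩
      x ^ a * y ^ q          ∎

    -- Here f and g stand for U and V, and `μ` turns the denominator V(ζʳ) U(ζ) into `k`. Writing p
    -- = r + 20q replaces ζᵖ by ζʳ and splits (p - 1)/2 as l + 10q, so that on the right q survives
    -- only in `t ^ q`.
    half-power-period : ∀ {p} → Prime p → p · 1# ≈ 0# → ∀ f g {ζ s t w μ k} r q l →
      p ≡ r ℕ.+ q ℕ.* 20 → r ≡ suc (2 ℕ.* l) → ζ ^ 20 ≈ 1# → s ^ 10 ≈ t →
      s * (⟦ f ⟧ ζ * ⟦ f ⟧ ζ) ≈ (⟦ g ⟧ ζ * ⟦ g ⟧ ζ) * w →
      ⟦ g ⟧ (ζ ^ r) * ⟦ f ⟧ ζ * μ ≈ k →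
      k * w ^ (l ℕ.+ q ℕ.* 10) ≈ t ^ q * (s ^ l * (⟦ f ⟧ (ζ ^ r) * ⟦ g ⟧ ζ) * μ)
    half-power-period {p} p-prime p≈0 f g {ζ} {s} {t} {w} {μ} {k} r q l p≡ r≡ ζ^20≈1 s^10≈t square inverse = begin
      k * w ^ n                                    ≈⟨ *-congʳ inverse ⟨
      ⟦ g ⟧ (ζ ^ r) * ⟦ f ⟧ ζ * μ * w ^ n
        ≈⟨ solve 4 (λ a b c d → a :* b :* c :* d := ((a :* d) :* b) :* c) refl (⟦ g ⟧ (ζ ^ r)) (⟦ f ⟧ ζ) μ (w ^ n) ⟩
      ((⟦ g ⟧ (ζ ^ r) * w ^ n) * ⟦ f ⟧ ζ) * μ      ≈⟨ *-congʳ (*-congʳ (*-congʳ (frobenius g))) ⟨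
      ((⟦ g ⟧ ζ ^ p * w ^ n) * ⟦ f ⟧ ζ) * μ        ≈⟨ *-congʳ (Frobenius.half-power R n p≡1+2n square) ⟨
      (s ^ n * (⟦ f ⟧ ζ ^ p * ⟦ g ⟧ ζ)) * μ        ≈⟨ *-congʳ (*-cong (^-period l 10 q s^10≈t) (*-congʳ (frobenius f))) ⟩
      ((s ^ l * t ^ q) * (⟦ f ⟧ (ζ ^ r) * ⟦ g ⟧ ζ)) * μ
        ≈⟨ solve 4 (λ a b c d → ((a :* b) :* c) :* d := b :* (a :* c :* d)) refl (s ^ l) (t ^ q) (⟦ f ⟧ (ζ ^ r) * ⟦ g ⟧ ζ) μ ⟩
      t ^ q * (s ^ l * (⟦ f ⟧ (ζ ^ r) * ⟦ g ⟧ ζ) * μ) ∎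
      where
      n = l ℕ.+ q ℕ.* 10

      p≡1+2n : p ≡ suc (2 ℕ.* n)
      p≡1+2n = ≡.trans p≡ (≡.trans (≡.cong (ℕ._+ q ℕ.* 20) r≡) (≡.cong suc (2l+20q l q)))

      ζ^p≈ζ^r : ζ ^ p ≈ ζ ^ r
      ζ^p≈ζ^r = begin
        ζ ^ p                  ≡⟨ ≡.cong (ζ ^_) p≡ ⟩
        ζ ^ (r ℕ.+ q ℕ.* 20)   ≈⟨ ^-period r 20 q ζ^20≈1 ⟩
        ζ ^ r * 1# ^ q         ≈⟨ *-congˡ (1^n≈1 q) ⟩
        ζ ^ r * 1#             ≈⟨ *-identityʳ _ ⟩
        ζ ^ r                  ∎

      frobenius : ∀ h → ⟦ h ⟧ ζ ^ p ≈ ⟦ h ⟧ (ζ ^ r)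
      frobenius h = trans (⟦⟧-frobenius p-prime p≈0 h ζ) (⟦⟧-cong h ζ^p≈ζ^r)

    -- The element z plays the role of y j / 2; with it, the first two hypotheses are free of the
    -- inverse `h` of 2.
    factor-half : ∀ {x y z j h two} → x ≈ y + z → y * j ≈ two * z → h * two ≈ 1# → x ≈ y * (1# + h * j)
    factor-half {x} {y} {z} {j} {h} {two} x≈y+z yj≈2z h2≈1 = begin
      x                      ≈⟨ x≈y+z ⟩
      y + z                  ≈⟨ +-congˡ (*-identityˡ z) ⟨
      y + 1# * z             ≈⟨ +-congˡ (*-congʳ h2≈1) ⟨
      y + h * two * z        ≈⟨ +-congˡ (*-assoc h two z) ⟩
      y + h * (two * z)      ≈⟨ +-congˡ (*-congˡ yj≈2z) ⟨
      y + h * (y * j)        ≈⟨ solve 3 (λ y h j → y :+ h :* (y :* j) := y :* (con 1 :+ h :* j)) refl y h j ⟩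
      y * (1# + h * j)       ∎

    square-product : ∀ {x y z w} → y * y ≈ z → w ≈ x * x * z → (x * y) * (x * y) ≈ w
    square-product {x} {y} {z} {w} y²≈z w≈x²z = begin
      (x * y) * (x * y)  ≈⟨ solve 2 (λ x y → (x :* y) :* (x :* y) := (x :* x) :* (y :* y)) refl x y ⟩
      (x * x) * (y * y)  ≈⟨ *-congˡ y²≈z ⟩
      (x * x) * z        ≈⟨ w≈x²z ⟨
      w                  ∎

  -- `constant` is the coordinate along 1. Its laws concern sums and products with scalars: these
  -- pass through a tower of quadratic extensions, and they are what the extraction of rational
  -- parts uses.
  record Extension (m : ℕ) : Set₁ where
    open Modular m using (ℤ/m; _≋_)
    field
      extension : CommutativeRing 0ℓ 0ℓ
    open CommutativeRing extension
    field
      ι : ℤ → Carrier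
      ι-cong : ∀ {x y} → x ≋ y → ι x ≈ ι y
      ι-0 : ι (+ 0) ≈ 0#
      ι-1 : ι (+ 1) ≈ 1#
      ι-+ : ∀ x y → ι (x ℤ.+ y) ≈ ι x + ι y
      ι-* : ∀ x y → ι (x ℤ.* y) ≈ ι x * ι y
      constant : Carrier → ℤ
      constant-cong : ∀ {x y} → x ≈ y → constant x ≋ constant y
      constant-ι+ : ∀ c x → constant (ι c + x) ≋ c ℤ.+ constant x
      constant-ι* : ∀ c x → constant (ι c * x) ≋ c ℤ.* constant x

  trivial : ∀ {m} → Extension m
  trivial {m} = record
    { extension = ℤ/m
    ; ι = λ x → x
    ; ι-cong = λ e → e
    ; ι-0 = refl
    ; ι-1 = refl
    ; ι-+ = λ _ _ → refl
    ; ι-* = λ _ _ → refl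
    ; constant = λ x → x
    ; constant-cong = λ e → e
    ; constant-ι+ = λ _ _ → refl
    ; constant-ι* = λ _ _ → refl
    }
    where
    open Modular m using (ℤ/m)
    open CommutativeRing ℤ/m using (refl)

  adjoin-root : ∀ {m} (X : Extension m) (u v : CommutativeRing.Carrier (Extension.extension X)) → Extension m
  adjoin-root {m} X u v = record
    { extension = Q.ring
    ; ι = λ x → Q.ι (ι x)
    ; ι-cong = λ e → Q.ι-cong (ι-cong e)
    ; ι-0 = Q.ι-cong ι-0
    ; ι-1 = Q.ι-cong ι-1
    ; ι-+ = λ x y → Q.trans (Q.ι-cong (ι-+ x y)) (Q.ι-+ (ι x) (ι y))
    ; ι-* = λ x y → Q.trans (Q.ι-cong (ι-* x y)) (Q.ι-* (ι x) (ι y))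
    ; constant = λ x → constant (fst x)
    ; constant-cong = λ e → constant-cong (Q.fst-≈ e)
    ; constant-ι+ = λ c x → B.trans (constant-cong (Q.fst-ι+ (ι c) x)) (constant-ι+ c (fst x))
    ; constant-ι* = λ c x → B.trans (constant-cong (Q.fst-ι* (ι c) x)) (constant-ι* c (fst x))
    }
    where
    open Extension X
    module B = CommutativeRing (Modular.ℤ/m m)
    module Q where
      open QuadraticExtension extension u v public
      open CommutativeRing ring public using (trans)

  module EvenPart {m : ℕ} (X : Extension m) where
    open Extension X
    open Modular m using (ℤ/m; _≋_; cong-mod)
    private module B = CommutativeRing ℤ/m
    open CommutativeRing extension hiding (zero)
    open import Algebra.Properties.CommutativeSemiring.Exp commutativeSemiring
    open import Algebra.Properties.Semiring.Mult semiring using () renaming (_×_ to _·_)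
    open Evaluation extension
    open Solver commutativeSemiring using (solve; _:=_; _:+_; _:*_; con)

    characteristic : m · 1# ≈ 0#
    characteristic = trans (·1≈ι m) (trans (ι-cong m≋0) ι-0)
      where
      ·1≈ι : ∀ n → n · 1# ≈ ι (+ n)
      ·1≈ι zero = sym ι-0
      ·1≈ι (suc n) = trans (+-cong (sym ι-1) (·1≈ι n)) (sym (ι-+ (+ 1) (+ n)))

      m≋0 : + m ≋ + 0
      m≋0 = cong-mod (+ 1) (≡.sym (≡.trans (ℤₚ.+-identityˡ _) (ℤₚ.*-identityˡ _)))

    ι-^ : ∀ x n → ι (x ℤ.^ n) ≈ ι x ^ n
    ι-^ x zero = ι-1
    ι-^ x (suc n) = trans (ι-* x (x ℤ.^ n)) (*-congˡ (ι-^ x n))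

    [1+x]^n-even-odd : ∀ {d x} → x * x ≈ ι d → ∀ n → (1# + x) ^ n ≈ ι (even d n) + ι (odd d n) * x
    [1+x]^n-even-odd {d} {x} x²≈d zero = sym (begin
      ι (+ 1) + ι (+ 0) * x   ≈⟨ +-cong ι-1 (*-congʳ ι-0) ⟩
      1# + 0# * x             ≈⟨ +-congˡ (zeroˡ x) ⟩
      1# + 0#                 ≈⟨ +-identityʳ 1# ⟩
      1#                      ∎)
      where open import Relation.Binary.Reasoning.Setoid setoid
    [1+x]^n-even-odd {d} {x} x²≈d (suc n) = begin
      (1# + x) * (1# + x) ^ n     ≈⟨ *-congˡ ([1+x]^n-even-odd x²≈d n) ⟩
      (1# + x) * (ι e + ι o * x)
        ≈⟨ solve 3 (λ x e o → (con 1 :+ x) :* (e :+ o :* x) := (e :+ x :* x :* o) :+ (e :+ o) :* x) refl x (ι e) (ι o) ⟩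
      (ι e + x * x * ι o) + (ι e + ι o) * x   ≈⟨ +-congʳ (+-congˡ (*-congʳ x²≈d)) ⟩
      (ι e + ι d * ι o) + (ι e + ι o) * x     ≈⟨ +-cong (+-congˡ (ι-* d o)) (*-congʳ (ι-+ e o)) ⟨
      (ι e + ι (d ℤ.* o)) + ι (e ℤ.+ o) * x   ≈⟨ +-congʳ (ι-+ e (d ℤ.* o)) ⟨
      ι (e ℤ.+ d ℤ.* o) + ι (e ℤ.+ o) * x     ∎
      where
      open import Relation.Binary.Reasoning.Setoid setoid
      e = even d n
      o = odd d n

    -- Expanding (1 + w)ⁿ leaves `even d n` plus a scalar multiple of `j`, whose coordinate along 1
    -- vanishes.
    constant-even : ∀ {d} w₀ j → let w = ι w₀ * j in w * w ≈ ι d → constant j ≡ + 0 → ∀ n → constant ((1# + w) ^ n) ≋ even d n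
    constant-even {d} w₀ j w²≈d j₀≡0 n = begin
      constant ((1# + w) ^ n)                        ≈⟨ constant-cong ([1+x]^n-even-odd w²≈d n) ⟩
      constant (ι (even d n) + ι (odd d n) * w)      ≈⟨ constant-ι+ (even d n) _ ⟩
      even d n ℤ.+ constant (ι (odd d n) * w)        ≈⟨ B.+-congˡ {even d n} (constant-ι* (odd d n) w) ⟩
      even d n ℤ.+ odd d n ℤ.* constant w            ≈⟨ B.+-congˡ {even d n} (B.*-congˡ {odd d n} (constant-ι* w₀ j)) ⟩
      even d n ℤ.+ odd d n ℤ.* (w₀ ℤ.* constant j)   ≡⟨ ≡.cong (λ x → even d n ℤ.+ odd d n ℤ.* (w₀ ℤ.* x)) j₀≡0 ⟩
      even d n ℤ.+ odd d n ℤ.* (w₀ ℤ.* + 0)          ≡⟨ lemma (even d n) (odd d n) w₀ ⟩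
      even d n                                       ∎
      where
      open import Relation.Binary.Reasoning.Setoid B.setoid
      w = ι w₀ * j
      lemma : ∀ a b c → a ℤ.+ b ℤ.* (c ℤ.* + 0) ≡ a
      lemma = solve-∀

    -- This is `half-power-period` read along the coordinate 1. The scalars `K` and 3125 = √5¹⁰ pass
    -- through `constant`, and what remains is one fixed element for each residue `r`. `K` stays on
    -- both sides until it can be cancelled modulo the prime.
    even-value : Prime m → ∀ f g {ζ i √5 μ d} → ζ ^ 20 ≈ 1# → √5 ^ 10 ≈ ι (+ 3125) → constant i ≡ + 0 →
      ∀ w₀ → let w = ι w₀ * i in w * w ≈ ι d →
      √5 * (⟦ f ⟧ ζ * ⟦ f ⟧ ζ) ≈ (⟦ g ⟧ ζ * ⟦ g ⟧ ζ) * (1# + w) →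
      ∀ r q l K c → m ≡ r ℕ.+ q ℕ.* 20 → r ≡ suc (2 ℕ.* l) →
      ⟦ g ⟧ (ζ ^ r) * ⟦ f ⟧ ζ * μ ≈ ι K →
      constant (√5 ^ l * (⟦ f ⟧ (ζ ^ r) * ⟦ g ⟧ ζ) * μ) ≡ K ℤ.* c →
      K ℤ.* even d (l ℕ.+ q ℕ.* 10) ≋ (+ 3125) ℤ.^ q ℤ.* (K ℤ.* c)
    even-value p-prime f g {ζ} {i} {√5} {μ} {d} ζ^20≈1 √5^10≈5^5 i₀≡0 w₀ w²≈d square r q l K c m≡ r≡ unit value = begin
      K ℤ.* even d n                  ≈⟨ B.*-congˡ {K} (constant-even w₀ i w²≈d i₀≡0 n) ⟨
      K ℤ.* constant ((1# + w) ^ n)   ≈⟨ constant-ι* K ((1# + w) ^ n) ⟨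
      constant (ι K * (1# + w) ^ n)
        ≈⟨ constant-cong (half-power-period p-prime characteristic f g r q l m≡ r≡ ζ^20≈1 √5^10≈5^5 square unit) ⟩
      constant (ι (+ 3125) ^ q * x)   ≈⟨ constant-cong (*-congʳ {x} (ι-^ (+ 3125) q)) ⟨
      constant (ι ((+ 3125) ℤ.^ q) * x) ≈⟨ constant-ι* ((+ 3125) ℤ.^ q) x ⟩
      (+ 3125) ℤ.^ q ℤ.* constant x   ≡⟨ ≡.cong ((+ 3125) ℤ.^ q ℤ.*_) value ⟩
      (+ 3125) ℤ.^ q ℤ.* (K ℤ.* c)    ∎
      where
      open import Relation.Binary.Reasoning.Setoid B.setoid
      n = l ℕ.+ q ℕ.* 10
      w = ι w₀ * i
      x = √5 ^ l * (⟦ f ⟧ (ζ ^ r) * ⟦ g ⟧ ζ) * μ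

  -- Residue classes modulo 20 and the evaluations in ℤ[ζ].

  data Residue : ℕ → Set where
    r1 : Residue 1
    r3 : Residue 3
    r7 : Residue 7
    r9 : Residue 9
    r11 : Residue 11
    r13 : Residue 13
    r17 : Residue 17
    r19 : Residue 19

  residue-odd : ∀ {r} → Residue r → r ≡ suc (2 ℕ.* (r ℕ./ 2))
  residue-odd r1 = ≡.refl
  residue-odd r3 = ≡.refl
  residue-odd r7 = ≡.refl
  residue-odd r9 = ≡.refl
  residue-odd r11 = ≡.refl
  residue-odd r13 = ≡.refl
  residue-odd r17 = ≡.refl
  residue-odd r19 = ≡.refl

  -- They are rational parts of U(ζʳ)/U(ζ), up to powers of √5 and φ and a sign. For U = φ³ + i this
  -- quotient is 1 if r = 1, 9; iφ⁻³ if r = 13, 17; (2 - i)/√5 if r = 11, 19; and -φ⁻³(1 + 2i)/√5 if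
  -- r = 3, 7. For U = (1 + i)(φ³ - i) the last two become (1 - 2i)/√5 and φ⁻³(2 + i)/√5. The factor
  -- φ⁻³ cancels against V(ζ)/V(ζʳ).
  coefficient₁ coefficient₂ : ∀ {r} → Residue r → ℤ
  coefficient₁ r1 = + 1
  coefficient₁ r3 = + 1
  coefficient₁ r7 = + 1
  coefficient₁ r9 = + 1
  coefficient₁ r11 = + 2
  coefficient₁ r13 = + 0
  coefficient₁ r17 = + 0
  coefficient₁ r19 = + 2
  coefficient₂ r1 = + 1
  coefficient₂ r3 = -[1+ 1 ]
  coefficient₂ r7 = -[1+ 1 ]
  coefficient₂ r9 = + 1
  coefficient₂ r11 = + 1
  coefficient₂ r13 = + 0
  coefficient₂ r17 = + 0
  coefficient₂ r19 = + 1

  -- The common shape of all right-hand sides: in the classes where the theorem has (p - 3)/4, p is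
  -- 3 modulo 4 and this exponent equals [p/4].
  leading : ℤ → ℕ → ℤ
  leading a n = a ℤ.* -[1+ 0 ] ℤ.^ ((n ℕ.+ 5) ℕ./ 10) ℤ.* (+ 5) ℤ.^ (n ℕ./ 4)

  module Cyclotomic (m : ℕ) where
    -- The tower φ² = φ + 1, η² = φ η - 1, ζ² = η is ℤ[ζ]/m for a primitive 20th root of unity ζ.
    -- It is opaque because it must not be unfolded in conversion checks; only _≟_ evaluates.
    opaque
      cyclotomic : Extension m
      cyclotomic =
        adjoin-root (adjoin-root (adjoin-root trivial
          (+ 1) (+ 1))
          ⟨ + 0 , + 1 ⟩ ⟨ -[1+ 0 ] , + 0 ⟩)
          ⟨ ⟨ + 0 , + 0 ⟩ , ⟨ + 0 , + 0 ⟩ ⟩ ⟨ ⟨ + 0 , + 0 ⟩ , ⟨ + 1 , + 0 ⟩ ⟩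

    open Modular m using (_≋_)
    open Extension cyclotomic
    open CommutativeRing extension hiding (zero)
    open import Algebra.Properties.CommutativeSemiring.Exp commutativeSemiring
    open Evaluation extension

    infix 4 _≟_

    opaque
      unfolding cyclotomic

      ζ √5 : Carrier
      ζ = ⟨ ⟨ ⟨ + 0 , + 0 ⟩ , ⟨ + 0 , + 0 ⟩ ⟩ , ⟨ ⟨ + 1 , + 0 ⟩ , ⟨ + 0 , + 0 ⟩ ⟩ ⟩
      √5 = ⟨ ⟨ ⟨ -[1+ 0 ] , + 2 ⟩ , ⟨ + 0 , + 0 ⟩ ⟩ , ⟨ ⟨ + 0 , + 0 ⟩ , ⟨ + 0 , + 0 ⟩ ⟩ ⟩

      _≟_ : DecidableEquality Carrier
      _≟_ = Pair-≟ (Pair-≟ (Pair-≟ ℤ._≟_))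

    -- A positive decision compares integer coordinates, so it is an equality in ℤ[ζ] itself and
    -- holds modulo every `m`. Stating it through `does` makes the checker compute a Boolean only.
    by-evaluation : ∀ {x y} → does (x ≟ y) ≡ true → x ≈ y
    by-evaluation {x} {y} e with yes x≡y ← x ≟ y = reflexive x≡y

    i : Carrier
    i = ζ ^ 5

    -- V = 2 φ (ζ + ζ⁻¹), where φ = ζ² + ζ⁻² is the golden ratio and (ζ + ζ⁻¹)² = √5 φ; these satisfy
    -- √5 U₁² = V² (1 + i/2) and √5 U₂² = V² (1 + 2i).
    φ U₁ U₂ V : Poly
    φ = mono 2 ⊞ mono 18
    U₁ = φ ⊠ φ ⊠ φ ⊞ mono 5
    U₂ = (one ⊞ mono 5) ⊠ (φ ⊠ φ ⊠ φ ⊞ mono 15)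
    V = (one ⊞ one) ⊠ φ ⊠ (mono 1 ⊞ mono 19)

    -- V(ζʳ)² V(ζ³ʳ)² and f(ζ) f(-ζ) f(ζ³) f(-ζ³) are norms, hence integers.
    cofactor : Poly → ℕ → Carrier
    cofactor f r = ⟦ V ⟧ (ζ ^ r) * (⟦ V ⟧ (ζ ^ (3 ℕ.* r)) * ⟦ V ⟧ (ζ ^ (3 ℕ.* r)))
      * (⟦ f ⟧ (- ζ) * (⟦ f ⟧ (ζ ^ 3) * ⟦ f ⟧ (- (ζ ^ 3))))

    opaque
      unfolding cyclotomic ζ _≟_

      eval-ζ^20 : does (ζ ^ 20 ≟ 1#) ≡ true
      eval-ζ^20 = ≡.refl

      eval-√5^10 : does (√5 ^ 10 ≟ ι (+ 3125)) ≡ true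
      eval-√5^10 = ≡.refl

      eval-i² : does (i * i ≟ ι -[1+ 0 ]) ≡ true
      eval-i² = ≡.refl

      constant-i : constant i ≡ + 0
      constant-i = ≡.refl

      -- The inverse of 2 varies with the prime, so 1 + i/2 is not a closed expression. With z = x -
      -- y, the two closed checks x = y + z and y i = 2z are made instead, and `factor-half`
      -- combines them.
      eval-square₁ : let x = √5 * (⟦ U₁ ⟧ ζ * ⟦ U₁ ⟧ ζ); y = ⟦ V ⟧ ζ * ⟦ V ⟧ ζ in
        does (x ≟ y + (x - y)) ≡ true
      eval-square₁ = ≡.refl

      eval-square₁′ : let x = √5 * (⟦ U₁ ⟧ ζ * ⟦ U₁ ⟧ ζ); y = ⟦ V ⟧ ζ * ⟦ V ⟧ ζ in
        does (y * i ≟ ι (+ 2) * (x - y)) ≡ true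
      eval-square₁′ = ≡.refl

      eval-square₂ : does (√5 * (⟦ U₂ ⟧ ζ * ⟦ U₂ ⟧ ζ) ≟ (⟦ V ⟧ ζ * ⟦ V ⟧ ζ) * (1# + ι (+ 2) * i)) ≡ true
      eval-square₂ = ≡.refl

      -- 1600 = 80 · 20. Of V(ζʳ)² and V(ζ³ʳ)² one is 4√5 φ³ and the other 4√5 φ⁻³, with product 80.
      -- The maps ζ ↦ ±ζ, ±ζ³ give the four embeddings of ℚ(√5, i), so the conjugates of φ³ + i
      -- multiply to (φ⁶ + 1)(φ⁻⁶ + 1) = 20.
      eval-unit₁ : ∀ {r} → Residue r → does (⟦ V ⟧ (ζ ^ r) * ⟦ U₁ ⟧ ζ * cofactor U₁ r ≟ ι (+ 1600)) ≡ true
      eval-unit₁ r1 = ≡.refl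
      eval-unit₁ r3 = ≡.refl
      eval-unit₁ r7 = ≡.refl
      eval-unit₁ r9 = ≡.refl
      eval-unit₁ r11 = ≡.refl
      eval-unit₁ r13 = ≡.refl
      eval-unit₁ r17 = ≡.refl
      eval-unit₁ r19 = ≡.refl

      eval-constant₁ : ∀ {r} (ρ : Residue r) →
        constant (√5 ^ (r ℕ./ 2) * (⟦ U₁ ⟧ (ζ ^ r) * ⟦ V ⟧ ζ) * cofactor U₁ r) ≡ + 1600 ℤ.* leading (coefficient₁ ρ) r
      eval-constant₁ r1 = ≡.refl
      eval-constant₁ r3 = ≡.refl
      eval-constant₁ r7 = ≡.refl
      eval-constant₁ r9 = ≡.refl
      eval-constant₁ r11 = ≡.refl
      eval-constant₁ r13 = ≡.refl
      eval-constant₁ r17 = ≡.refl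
      eval-constant₁ r19 = ≡.refl

      -- 6400 = 80 · 80: the factor 1 + i of `U₂` multiplies the norm 20 by (1 + i)²(1 - i)² = 4.
      eval-unit₂ : ∀ {r} → Residue r → does (⟦ V ⟧ (ζ ^ r) * ⟦ U₂ ⟧ ζ * cofactor U₂ r ≟ ι (+ 6400)) ≡ true
      eval-unit₂ r1 = ≡.refl
      eval-unit₂ r3 = ≡.refl
      eval-unit₂ r7 = ≡.refl
      eval-unit₂ r9 = ≡.refl
      eval-unit₂ r11 = ≡.refl
      eval-unit₂ r13 = ≡.refl
      eval-unit₂ r17 = ≡.refl
      eval-unit₂ r19 = ≡.refl

      eval-constant₂ : ∀ {r} (ρ : Residue r) →
        constant (√5 ^ (r ℕ./ 2) * (⟦ U₂ ⟧ (ζ ^ r) * ⟦ V ⟧ ζ) * cofactor U₂ r) ≡ + 6400 ℤ.* leading (coefficient₂ ρ) r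
      eval-constant₂ r1 = ≡.refl
      eval-constant₂ r3 = ≡.refl
      eval-constant₂ r7 = ≡.refl
      eval-constant₂ r9 = ≡.refl
      eval-constant₂ r11 = ≡.refl
      eval-constant₂ r13 = ≡.refl
      eval-constant₂ r17 = ≡.refl
      eval-constant₂ r19 = ≡.refl

    square₁ : ∀ h → h ℤ.* + 2 ≋ + 1 → √5 * (⟦ U₁ ⟧ ζ * ⟦ U₁ ⟧ ζ) ≈ (⟦ V ⟧ ζ * ⟦ V ⟧ ζ) * (1# + ι h * i)
    square₁ h 2h≈1 = factor-half (by-evaluation eval-square₁) (by-evaluation eval-square₁′)
      (trans (sym (ι-* h (+ 2))) (trans (ι-cong 2h≈1) ι-1))

    -- `d` is free up to congruence because the binomial sum supplies 16 g, which agrees with -w²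
    -- only modulo the prime.
    [ιw*i]² : ∀ w {d} → d ≋ w ℤ.* w ℤ.* -[1+ 0 ] → (ι w * i) * (ι w * i) ≈ ι d
    [ιw*i]² w d≋ = square-product (by-evaluation eval-i²)
      (trans (ι-cong d≋) (trans (ι-* (w ℤ.* w) -[1+ 0 ]) (*-congʳ (ι-* w w))))

    module _ (m-prime : Prime m) {r : ℕ} (q : ℕ) (ρ : Residue r) (m≡ : m ≡ r ℕ.+ q ℕ.* 20) where
      open EvenPart cyclotomic using (even-value)

      even-value₁ : ∀ h {d} → h ℤ.* + 2 ≋ + 1 → d ≋ h ℤ.* h ℤ.* -[1+ 0 ] →
        + 1600 ℤ.* even d (r ℕ./ 2 ℕ.+ q ℕ.* 10) ≋ (+ 3125) ℤ.^ q ℤ.* (+ 1600 ℤ.* leading (coefficient₁ ρ) r)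
      even-value₁ h h2≋1 d≋ = even-value m-prime U₁ V (by-evaluation eval-ζ^20) (by-evaluation eval-√5^10) constant-i
        h ([ιw*i]² h d≋) (square₁ h h2≋1) r q (r ℕ./ 2) (+ 1600) (leading (coefficient₁ ρ) r) m≡ (residue-odd ρ)
        (by-evaluation (eval-unit₁ ρ)) (eval-constant₁ ρ)

      even-value₂ : ∀ {d} → d ≋ + 2 ℤ.* + 2 ℤ.* -[1+ 0 ] →
        + 6400 ℤ.* even d (r ℕ./ 2 ℕ.+ q ℕ.* 10) ≋ (+ 3125) ℤ.^ q ℤ.* (+ 6400 ℤ.* leading (coefficient₂ ρ) r)
      even-value₂ d≋ = even-value m-prime U₂ V (by-evaluation eval-ζ^20) (by-evaluation eval-√5^10) constant-i
        (+ 2) ([ιw*i]² (+ 2) d≋) (by-evaluation eval-square₂) r q (r ℕ./ 2) (+ 6400) (leading (coefficient₂ ρ) r) m≡ (residue-odd ρ)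
        (by-evaluation (eval-unit₂ ρ)) (eval-constant₂ ρ)

-- The binomial sums modulo a prime as even parts of powers.

module IntegerSums where
  open Rings
  open Binomials
  open CyclotomicPowers using (even; odd)
  open import Algebra.Bundles using (CommutativeRing)
  open import Data.Nat as ℕ using (ℕ; zero; suc)
  import Data.Nat.Properties as ℕₚ
  import Data.Nat.Divisibility as ℕ∣
  open import Data.Nat.Combinatorics using (_C_; k>n⇒nCk≡0; nCk+nC[k+1]≡[n+1]C[k+1])
  open import Data.Nat.Primality using (Prime; euclidsLemma)
  open import Data.Integer using (ℤ; +_; -[1+_]; ∣_∣; _+_; _*_; _^_; -_; _-_)
  import Data.Integer.Properties as ℤₚ
  open import Data.Integer.Tactic.RingSolver using (solve-∀)
  open import Data.Sum using ([_,_]′)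
  open import Relation.Nullary using (¬_; contradiction)
  open import Relation.Binary.PropositionalEquality as ≡ using (_≡_; cong; cong₂; module ≡-Reasoning)

  ^-distrib-* : ∀ x y n → (x * y) ^ n ≡ x ^ n * y ^ n
  ^-distrib-* x y zero = ≡.refl
  ^-distrib-* x y (suc n) = ≡.trans (cong (x * y *_) (^-distrib-* x y n)) (interchange x y (x ^ n) (y ^ n))
    where
    interchange : ∀ a b c d → a * b * (c * d) ≡ a * c * (b * d)
    interchange = solve-∀

  ∑≤ : ℕ → (ℕ → ℤ) → ℤ
  ∑≤ zero f = f 0
  ∑≤ (suc N) f = ∑≤ N f + f (suc N)

  ∑≤-+ : ∀ N f g → ∑≤ N (λ k → f k + g k) ≡ ∑≤ N f + ∑≤ N g
  ∑≤-+ zero f g = ≡.refl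
  ∑≤-+ (suc N) f g = ≡.trans (cong (_+ (f (suc N) + g (suc N))) (∑≤-+ N f g)) (interchange (∑≤ N f) (∑≤ N g) (f (suc N)) (g (suc N)))
    where
    interchange : ∀ a b c d → (a + b) + (c + d) ≡ (a + c) + (b + d)
    interchange = solve-∀

  ∑≤-cong : ∀ N {f g} → (∀ k → f k ≡ g k) → ∑≤ N f ≡ ∑≤ N g
  ∑≤-cong zero e = e 0
  ∑≤-cong (suc N) e = cong₂ _+_ (∑≤-cong N e) (e (suc N))

  pascal : ∀ n k → + (suc n C suc k) ≡ + (n C k) + + (n C suc k)
  pascal n k = cong +_ (≡.sym (nCk+nC[k+1]≡[n+1]C[k+1] n k))

  -- Pascal's rule splits C(n + 1, 2k) into C(n, 2k - 1) + C(n, 2k), and reindexing the first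
  -- summand produces the factor `d`. The odd binomial with k = N falls just beyond the range, hence
  -- the extra term on the left.
  even-step : ∀ d n N → ∑≤ N (λ k → + (suc n C (2 ℕ.* k)) * d ^ k) + + (n C suc (2 ℕ.* N)) * d ^ suc N
    ≡ ∑≤ N (λ k → + (n C (2 ℕ.* k)) * d ^ k) + d * ∑≤ N (λ k → + (n C suc (2 ℕ.* k)) * d ^ k)
  even-step d n zero = base (+ (n C 1)) d
    where
    base : ∀ c d → + 1 * + 1 + c * (d * + 1) ≡ + 1 * + 1 + d * (c * + 1)
    base = solve-∀
  even-step d n (suc N) = begin
    (S + + (suc n C (2 ℕ.* suc N)) * D) + c₃ * (d * D)
      ≡⟨ cong (λ x → (S + x * D) + c₃ * (d * D)) even-pascal ⟩
    (S + (c₁ + c₂) * D) + c₃ * (d * D)  ≡⟨ regroup S c₁ c₂ c₃ d D ⟩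
    (S + c₁ * D) + (c₂ * D + d * (c₃ * D))  ≡⟨ cong (_+ (c₂ * D + d * (c₃ * D))) (even-step d n N) ⟩
    (E + d * O) + (c₂ * D + d * (c₃ * D))   ≡⟨ distribute E O c₂ c₃ d D ⟩
    (E + c₂ * D) + d * (O + c₃ * D)         ∎
    where
    open ≡-Reasoning
    D = d ^ suc N
    S = ∑≤ N (λ k → + (suc n C (2 ℕ.* k)) * d ^ k)
    E = ∑≤ N (λ k → + (n C (2 ℕ.* k)) * d ^ k)
    O = ∑≤ N (λ k → + (n C suc (2 ℕ.* k)) * d ^ k)
    c₁ = + (n C suc (2 ℕ.* N))
    c₂ = + (n C (2 ℕ.* suc N))
    c₃ = + (n C suc (2 ℕ.* suc N))
    even-pascal : + (suc n C (2 ℕ.* suc N)) ≡ c₁ + c₂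
    even-pascal = ≡.subst (λ j → + (suc n C j) ≡ c₁ + + (n C j)) (≡.sym (ℕₚ.*-suc 2 N)) (pascal n (suc (2 ℕ.* N)))
    regroup : ∀ S c₁ c₂ c₃ d D → (S + (c₁ + c₂) * D) + c₃ * (d * D) ≡ (S + c₁ * D) + (c₂ * D + d * (c₃ * D))
    regroup = solve-∀
    distribute : ∀ E O c₂ c₃ d D → (E + d * O) + (c₂ * D + d * (c₃ * D)) ≡ (E + c₂ * D) + d * (O + c₃ * D)
    distribute = solve-∀

  odd-step : ∀ d n N → ∑≤ N (λ k → + (suc n C suc (2 ℕ.* k)) * d ^ k)
    ≡ ∑≤ N (λ k → + (n C (2 ℕ.* k)) * d ^ k) + ∑≤ N (λ k → + (n C suc (2 ℕ.* k)) * d ^ k)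
  odd-step d n N = ≡.trans
    (∑≤-cong N (λ k → ≡.trans (cong (_* d ^ k) (pascal n (2 ℕ.* k))) (ℤₚ.*-distribʳ-+ (d ^ k) (+ (n C (2 ℕ.* k))) (+ (n C suc (2 ℕ.* k))))))
    (∑≤-+ N _ _)

  -- The bound on n places every nonzero C(n, j) in one of the two sums. The two parities are proved
  -- together, since each step of the recursion mixes them.
  ∑≤-even : ∀ d n N → n ℕ.≤ suc (2 ℕ.* N) → ∑≤ N (λ k → + (n C (2 ℕ.* k)) * d ^ k) ≡ even d n
  ∑≤-odd : ∀ d n N → n ℕ.≤ suc (2 ℕ.* N) → ∑≤ N (λ k → + (n C suc (2 ℕ.* k)) * d ^ k) ≡ odd d n

  ∑≤-even d zero N _ = only-first N
    where
    only-first : ∀ N → ∑≤ N (λ k → + (0 C (2 ℕ.* k)) * d ^ k) ≡ + 1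
    only-first zero = ≡.refl
    only-first (suc N) = cong₂ _+_ (only-first N) (ℤₚ.*-zeroˡ (d ^ suc N))
  ∑≤-even d (suc n) N n≤ = begin
    S                        ≡⟨ ℤₚ.+-identityʳ S ⟨
    S + + 0                  ≡⟨ cong (λ x → S + x) (ℤₚ.*-zeroˡ (d ^ suc N)) ⟨
    -- Here n ≤ 2N, so C(n, 2N + 1) = 0 and the boundary term of `even-step` can be inserted.
    S + + 0 * d ^ suc N      ≡⟨ cong (λ c → S + + c * d ^ suc N) (k>n⇒nCk≡0 n≤) ⟨
    S + + (n C suc (2 ℕ.* N)) * d ^ suc N   ≡⟨ even-step d n N ⟩
    _                        ≡⟨ cong₂ (λ e o → e + d * o) (∑≤-even d n N (ℕₚ.<⇒≤ n≤)) (∑≤-odd d n N (ℕₚ.<⇒≤ n≤)) ⟩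
    even d (suc n)           ∎
    where
    open ≡-Reasoning
    S = ∑≤ N (λ k → + (suc n C (2 ℕ.* k)) * d ^ k)

  ∑≤-odd d zero N _ = all-zero N
    where
    all-zero : ∀ N → ∑≤ N (λ k → + (0 C suc (2 ℕ.* k)) * d ^ k) ≡ + 0
    all-zero zero = ≡.refl
    all-zero (suc N) = cong₂ _+_ (all-zero N) (ℤₚ.*-zeroˡ (d ^ suc N))
  ∑≤-odd d (suc n) N n≤ = ≡.trans (odd-step d n N)
    (cong₂ _+_ (∑≤-even d n N (ℕₚ.<⇒≤ n≤)) (∑≤-odd d n N (ℕₚ.<⇒≤ n≤)))

  open import Algebra.Properties.AbelianGroup ℤₚ.+-0-abelianGroup using () renaming (∙-cancelʳ to +-cancelʳ)

  module PrimeModulus (p : ℕ) (p-prime : Prime p) where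
    open Modular p
    private module B = CommutativeRing ℤ/m

    ∣⇒≋0 : ∀ {x} → p ℕ∣.∣ ∣ x ∣ → x ≋ + 0
    ∣⇒≋0 {+ _} (ℕ∣.divides q ≡.refl) = cong-mod (+ q) (≡.trans (ℤₚ.pos-* q p) (≡.sym (ℤₚ.+-identityˡ _)))
    ∣⇒≋0 { -[1+ _ ]} (ℕ∣.divides q eq) = cong-mod (- + q) (≡.trans (cong (λ x → - + x) eq)
      (≡.trans (cong -_ (ℤₚ.pos-* q p)) (≡.trans (ℤₚ.neg-distribˡ-* (+ q) (+ p)) (≡.sym (ℤₚ.+-identityˡ _)))))

    ≋0⇒∣ : ∀ {x} → x ≋ + 0 → p ℕ∣.∣ ∣ x ∣
    ≋0⇒∣ {x} (cong-mod q eq) = ℕ∣.divides ∣ q ∣ (≡.trans (cong ∣_∣ (≡.trans eq (ℤₚ.+-identityˡ (q * + p)))) (ℤₚ.abs-* q (+ p)))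

    ≋-cancel : ∀ k {x y} → ¬ (p ℕ∣.∣ ∣ k ∣) → k * x ≋ k * y → x ≋ y
    ≋-cancel k {x} {y} p∤k kx≋ky = B.trans (≋-reflexive (recombine x y))
      (B.trans (B.+-congˡ {y} (∣⇒≋0 p∣x-y)) (B.+-identityʳ y))
      where
      expand : ∀ k x y → k * (x - y) ≡ k * x + - (k * y)
      expand = solve-∀
      recombine : ∀ x y → x ≡ y + (x - y)
      recombine = solve-∀
      k[x-y]≋0 : k * (x - y) ≋ + 0
      k[x-y]≋0 = B.trans (≋-reflexive (expand k x y)) (B.trans (B.+-congʳ { - (k * y)} kx≋ky) (B.-‿inverseʳ (k * y)))
      p∣x-y : p ℕ∣.∣ ∣ x - y ∣
      p∣x-y = [ (λ d → contradiction d p∤k) , (λ d → d) ]′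
        (euclidsLemma ∣ k ∣ ∣ x - y ∣ p-prime (≡.subst (p ℕ∣.∣_) (ℤₚ.abs-* k (x - y)) (≋0⇒∣ k[x-y]≋0)))

    -- Compare ratios of successive terms: after multiplication by k + 1 they are 2(2k + 1) and -4(n
    -- - k), which agree because 2n ≡ -1. The bound k < p allows k + 1 to be cancelled at each step.
    central-binomial : ∀ n → p ≡ suc (2 ℕ.* n) → ∀ k → k ℕ.< p → + ((2 ℕ.* k) C k) ≋ (- + 4) ^ k * + (n C k)
    central-binomial n p≡ zero _ = B.refl
    central-binomial n p≡ (suc k) k<p = ≋-cancel (+ suc k) (λ d → ℕₚ.<⇒≱ k<p (ℕ∣.∣⇒≤ d)) (begin
      + suc k * + ((2 ℕ.* suc k) C suc k)          ≡⟨ ℤₚ.pos-* (suc k) ((2 ℕ.* suc k) C suc k) ⟨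
      + (suc k ℕ.* ((2 ℕ.* suc k) C suc k))        ≡⟨ cong +_ (central-succ k) ⟩
      + (2 ℕ.* (suc (2 ℕ.* k) ℕ.* a))              ≡⟨ ≡.trans (ℤₚ.pos-* 2 (suc (2 ℕ.* k) ℕ.* a)) (cong (+ 2 *_) (ℤₚ.pos-* (suc (2 ℕ.* k)) a)) ⟩
      + 2 * (+ suc (2 ℕ.* k) * + a)                ≈⟨ B.*-congˡ {+ 2} (B.*-congˡ {+ suc (2 ℕ.* k)} (central-binomial n p≡ k (ℕₚ.<-trans (ℕₚ.n<1+n k) k<p))) ⟩
      + 2 * (+ suc (2 ℕ.* k) * (w * + b))          ≈⟨ reduce ⟩
      + suc k * (- + 4 * w * + c)                  ∎)
      where
      open import Relation.Binary.Reasoning.Setoid B.setoid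
      a = (2 ℕ.* k) C k
      b = n C k
      c = n C suc k
      w = (- + 4) ^ k
      recurrence : + suc k * + c + + k * + b ≡ + n * + b
      recurrence = ≡.trans (cong₂ _+_ (≡.sym (ℤₚ.pos-* (suc k) c)) (≡.sym (ℤₚ.pos-* k b)))
        (≡.trans (cong +_ (C-succ-lower n k)) (ℤₚ.pos-* n b))
      +p : + p ≡ + 1 + + 2 * + n
      +p = ≡.trans (cong +_ p≡) (cong (λ x → + 1 + x) (ℤₚ.pos-* 2 n))
      algebra : ∀ k n w b c → + 2 * ((+ 1 + + 2 * k) * (w * b)) + - + 4 * w * ((+ 1 + k) * c + k * b)
        ≡ ((+ 1 + k) * (- + 4 * w * c) + - + 4 * w * (n * b)) + (+ 2 * w * b) * (+ 1 + + 2 * n)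
      algebra = solve-∀
      reduce : + 2 * (+ suc (2 ℕ.* k) * (w * + b)) ≋ + suc k * (- + 4 * w * + c)
      -- The recurrence for C(n, k + 1) is additive, so -4 w n C(n, k) is added to both sides. They
      -- then differ by 2 w C(n, k) (1 + 2n), whence the quotient.
      reduce = cong-mod (+ 2 * w * + b) (+-cancelʳ (- + 4 * w * (+ n * + b)) _ _ (≡-Reasoning.begin
        + 2 * (+ suc (2 ℕ.* k) * (w * + b)) + - + 4 * w * (+ n * + b)
          ≡-Reasoning.≡⟨ cong₂ (λ x y → + 2 * (x * (w * + b)) + - + 4 * w * y) (cong (λ x → + 1 + x) (ℤₚ.pos-* 2 k)) (≡.sym recurrence) ⟩
        + 2 * ((+ 1 + + 2 * + k) * (w * + b)) + - + 4 * w * (+ suc k * + c + + k * + b)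
          ≡-Reasoning.≡⟨ algebra (+ k) (+ n) w (+ b) (+ c) ⟩
        (+ suc k * (- + 4 * w * + c) + - + 4 * w * (+ n * + b)) + (+ 2 * w * + b) * (+ 1 + + 2 * + n)
          ≡-Reasoning.≡⟨ cong (λ x → (+ suc k * (- + 4 * w * + c) + - + 4 * w * (+ n * + b)) + (+ 2 * w * + b) * x) +p ⟨
        (+ suc k * (- + 4 * w * + c) + - + 4 * w * (+ n * + b)) + (+ 2 * w * + b) * + p
          ≡-Reasoning.≡⟨ swap (+ suc k * (- + 4 * w * + c)) (- + 4 * w * (+ n * + b)) ((+ 2 * w * + b) * + p) ⟩
        (+ suc k * (- + 4 * w * + c) + (+ 2 * w * + b) * + p) + - + 4 * w * (+ n * + b) ≡-Reasoning.∎))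
        where
        swap : ∀ x y z → (x + y) + z ≡ (x + z) + y
        swap = solve-∀

    ∑≤-≋ : ∀ N {f g} → (∀ k → k ℕ.≤ N → f k ≋ g k) → ∑≤ N f ≋ ∑≤ N g
    ∑≤-≋ zero e = e 0 ℕ.z≤n
    ∑≤-≋ (suc N) e = B.+-cong (∑≤-≋ N (λ k k≤N → e k (ℕₚ.m≤n⇒m≤1+n k≤N))) (e (suc N) ℕₚ.≤-refl)

    -- `central-binomial` at index 2k contributes (-4)²ᵏ = 16ᵏ. The bound 2N < p keeps these indices
    -- in its range, and n ≤ 2N + 1 makes the truncated sum the whole even part.
    ∑-C4k2k : ∀ g n N → p ≡ suc (2 ℕ.* n) → n ℕ.≤ suc (2 ℕ.* N) → 2 ℕ.* N ℕ.< p →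
      ∑≤ N (λ k → + ((4 ℕ.* k) C (2 ℕ.* k)) * g ^ k) ≋ even (+ 16 * g) n
    ∑-C4k2k g n N p≡ n≤ 2N<p = B.trans (∑≤-≋ N term) (≋-reflexive (∑≤-even (+ 16 * g) n N n≤))
      where
      open import Relation.Binary.Reasoning.Setoid B.setoid
      4^2k : ∀ k → (- + 4) ^ (2 ℕ.* k) * g ^ k ≡ (+ 16 * g) ^ k
      4^2k k = ≡.trans (cong (_* g ^ k) (≡.sym (ℤₚ.^-*-assoc (- + 4) 2 k))) (≡.sym (^-distrib-* (+ 16) g k))
      term : ∀ k → k ℕ.≤ N → + ((4 ℕ.* k) C (2 ℕ.* k)) * g ^ k ≋ + (n C (2 ℕ.* k)) * (+ 16 * g) ^ k
      term k k≤N = begin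
        + ((4 ℕ.* k) C (2 ℕ.* k)) * g ^ k            ≡⟨ cong (λ x → + (x C (2 ℕ.* k)) * g ^ k) (ℕₚ.*-assoc 2 2 k) ⟩
        + ((2 ℕ.* (2 ℕ.* k)) C (2 ℕ.* k)) * g ^ k    ≈⟨ B.*-congʳ {g ^ k} (central-binomial n p≡ (2 ℕ.* k) (ℕₚ.≤-<-trans (ℕₚ.*-monoʳ-≤ 2 k≤N) 2N<p)) ⟩
        (- + 4) ^ (2 ℕ.* k) * + (n C (2 ℕ.* k)) * g ^ k  ≡⟨ rotate ((- + 4) ^ (2 ℕ.* k)) (+ (n C (2 ℕ.* k))) (g ^ k) ⟩
        + (n C (2 ℕ.* k)) * ((- + 4) ^ (2 ℕ.* k) * g ^ k)  ≡⟨ cong (+ (n C (2 ℕ.* k)) *_) (4^2k k) ⟩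
        + (n C (2 ℕ.* k)) * (+ 16 * g) ^ k           ∎
        where
        rotate : ∀ a b c → a * b * c ≡ b * (a * c)
        rotate = solve-∀

-- Reduction modulo p of rationals with denominator prime to p.

module Rationals where
  open import Defs
  open Rings
  open IntegerSums
  open import Algebra.Bundles using (CommutativeRing)
  open import Data.Nat as ℕ using (ℕ; zero; suc)
  import Data.Nat.Properties as ℕₚ
  import Data.Nat.Divisibility as ℕ∣
  import Data.Nat.Coprimality as Coprime
  open import Data.Nat.Primality using (Prime; euclidsLemma; prime⇒nonTrivial)
  open import Data.Integer as ℤ using (ℤ; +_; ∣_∣; -_)
  import Data.Integer.Properties as ℤₚ
  open import Data.Integer.Tactic.RingSolver using (solve-∀)
  open import Data.Product using (_,_)
  open import Data.Rational as ℚ using (ℚ; mkℚ; toℚᵘ)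
  import Data.Rational.Properties as ℚₚ
  open import Data.Rational.Unnormalised as ℚᵘ using (ℚᵘ; mkℚᵘ; _≃_; *≡*)
  import Data.Rational.Unnormalised.Properties as ℚᵘₚ
  open import Data.Sum using ([_,_]′)
  open import Relation.Nullary using (¬_; contradiction)
  open import Relation.Binary.PropositionalEquality as ≡ using (_≡_; cong)

  module Reduction (p : ℕ) (p-prime : Prime p) where
    open Modular p
    open PrimeModulus p p-prime
    private module B = CommutativeRing ℤ/m

    infix 4 _↦_
    -- The witness is an unnormalised fraction, since operations on ℚ pass to lowest terms and
    -- obscure how numerators and denominators arise.
    record _↦_ (a : ℚ) (x : ℤ) : Set where
      constructor reduces
      field
        fraction : ℚᵘ
        same : toℚᵘ a ≃ fraction
        p∤denominator : ¬ (p ℕ∣.∣ ℚᵘ.↧ₙ fraction)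
        numerator : ℚᵘ.↥ fraction ≋ x ℤ.* ℚᵘ.↧ fraction

    ∤-* : ∀ {a b} → ¬ (p ℕ∣.∣ a) → ¬ (p ℕ∣.∣ b) → ¬ (p ℕ∣.∣ a ℕ.* b)
    ∤-* {a} {b} p∤a p∤b d = [ p∤a , p∤b ]′ (euclidsLemma a b p-prime d)

    ↦-/ : ∀ n d-1 {x} → ¬ (p ℕ∣.∣ suc d-1) → n ≋ x ℤ.* + suc d-1 → n ℚ./ suc d-1 ↦ x
    ↦-/ n d-1 p∤d e = reduces (mkℚᵘ n d-1) (ℚₚ.toℚᵘ-fromℚᵘ (mkℚᵘ n d-1)) p∤d e

    ↦-ℤ : ∀ n → ℤ→ℚ n ↦ n
    ↦-ℤ n = ↦-/ n 0 (λ d → contradiction (ℕ∣.∣1⇒≡1 d) (ℕₚ.>⇒≢ (ℕ.nonTrivial⇒n>1 p)))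
      (≋-reflexive (≡.sym (ℤₚ.*-identityʳ n)))
      where instance _ = prime⇒nonTrivial p-prime

    ↦-+ : ∀ {a b x y} → a ↦ x → b ↦ y → a ℚ.+ b ↦ x ℤ.+ y
    ↦-+ {a} {b} {x} {y} (reduces u@(mkℚᵘ m c) a≃u p∤c m≋) (reduces v@(mkℚᵘ n d) b≃v p∤d n≋) =
      reduces (u ℚᵘ.+ v) (ℚᵘₚ.≃-trans (ℚₚ.toℚᵘ-homo-+ a b) (ℚᵘₚ.+-cong a≃u b≃v)) (∤-* p∤c p∤d) (begin
        m ℤ.* D ℤ.+ n ℤ.* C                    ≈⟨ B.+-cong (B.*-congʳ {D} m≋) (B.*-congʳ {C} n≋) ⟩
        (x ℤ.* C) ℤ.* D ℤ.+ (y ℤ.* D) ℤ.* C    ≡⟨ collect x y C D ⟩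
        (x ℤ.+ y) ℤ.* (C ℤ.* D)                ≡⟨ cong ((x ℤ.+ y) ℤ.*_) (ℤₚ.pos-* (suc c) (suc d)) ⟨
        (x ℤ.+ y) ℤ.* + (suc c ℕ.* suc d)      ∎)
      where
      open import Relation.Binary.Reasoning.Setoid B.setoid
      C = + suc c
      D = + suc d
      collect : ∀ x y C D → (x ℤ.* C) ℤ.* D ℤ.+ (y ℤ.* D) ℤ.* C ≡ (x ℤ.+ y) ℤ.* (C ℤ.* D)
      collect = solve-∀

    ↦-* : ∀ {a b x y} → a ↦ x → b ↦ y → a ℚ.* b ↦ x ℤ.* y
    ↦-* {a} {b} {x} {y} (reduces u@(mkℚᵘ m c) a≃u p∤c m≋) (reduces v@(mkℚᵘ n d) b≃v p∤d n≋) =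
      reduces (u ℚᵘ.* v) (ℚᵘₚ.≃-trans (ℚₚ.toℚᵘ-homo-* a b) (ℚᵘₚ.*-cong a≃u b≃v)) (∤-* p∤c p∤d) (begin
        m ℤ.* n                                ≈⟨ B.*-cong m≋ n≋ ⟩
        (x ℤ.* C) ℤ.* (y ℤ.* D)                ≡⟨ collect x y C D ⟩
        (x ℤ.* y) ℤ.* (C ℤ.* D)                ≡⟨ cong ((x ℤ.* y) ℤ.*_) (ℤₚ.pos-* (suc c) (suc d)) ⟨
        (x ℤ.* y) ℤ.* + (suc c ℕ.* suc d)      ∎)
      where
      open import Relation.Binary.Reasoning.Setoid B.setoid
      C = + suc c
      D = + suc d
      collect : ∀ x y C D → (x ℤ.* C) ℤ.* (y ℤ.* D) ≡ (x ℤ.* y) ℤ.* (C ℤ.* D)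
      collect = solve-∀

    ↦-neg : ∀ {a x} → a ↦ x → ℚ.- a ↦ - x
    ↦-neg {a} {x} (reduces u@(mkℚᵘ m c) a≃u p∤c m≋) =
      reduces (ℚᵘ.- u) (ℚᵘₚ.≃-trans (ℚₚ.toℚᵘ-homo‿- a) (ℚᵘₚ.-‿cong a≃u)) p∤c
        (B.trans (B.-‿cong m≋) (≋-reflexive (ℤₚ.neg-distribˡ-* x (+ suc c))))

    ↦-^ : ∀ {a x} → a ↦ x → ∀ n → a ^ℚ n ↦ x ℤ.^ n
    ↦-^ r zero = ↦-ℤ (+ 1)
    ↦-^ r (suc n) = ↦-* r (↦-^ r n)

    ↦-∑ : ∀ {f g} → (∀ k → f k ↦ g k) → ∀ N → Σ≤ N f ↦ ∑≤ N g
    ↦-∑ r zero = r 0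
    ↦-∑ r (suc N) = ↦-+ (↦-∑ r N) (r (suc N))

    -- If i/(e + 1) in lowest terms equals the witness m/(c + 1), then i(c + 1) = m(e + 1). As p
    -- divides m but not c + 1, it divides i.
    ↦0⇒∣ : ∀ {a x} → a ↦ x → x ≋ + 0 → p ℕ∣.∣ ∣ ℚ.↥ a ∣
    ↦0⇒∣ {mkℚ i e _} (reduces (mkℚᵘ m c) (*≡* eq) p∤c m≋) x≋0 =
      [ (λ d → d) , (λ d → contradiction d p∤c) ]′ (euclidsLemma ∣ i ∣ (suc c) p-prime p∣product)
      where
      m≋0 : m ≋ + 0
      m≋0 = B.trans m≋ (B.trans (B.*-congʳ {+ suc c} x≋0) (B.zeroˡ (+ suc c)))
      p∣product : p ℕ∣.∣ ∣ i ∣ ℕ.* suc c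
      p∣product = ≡.subst (p ℕ∣.∣_) (≡.trans (cong ∣_∣ (≡.sym eq)) (ℤₚ.abs-* i (+ suc c)))
        (≋0⇒∣ (B.trans (B.*-congʳ {+ suc e} m≋0) (B.zeroˡ (+ suc e))))

    -- In lowest terms p cannot divide both parts; thus one half of the congruence on ℚ yields the
    -- other.
    numerator⇒∤denominator : ∀ a → p ℕ∣.∣ ∣ ℚ.↥ a ∣ → ¬ (p ℕ∣.∣ ℚ.↧ₙ a)
    numerator⇒∤denominator (mkℚ i e c) p∣i p∣e =
      contradiction (Coprime.recompute c (p∣i , p∣e)) (ℕₚ.>⇒≢ (ℕ.nonTrivial⇒n>1 p))
      where instance _ = prime⇒nonTrivial p-prime

    ↦⇒modℚ : ∀ {a b x y} → a ↦ x → b ↦ y → x ≋ y → a ≡ b [modℚ p ]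
    ↦⇒modℚ {a} {b} {x} {y} a↦x b↦y x≋y = numerator⇒∤denominator (a ℚ.- b) p∣ , p∣
      where
      p∣ : p ℕ∣.∣ ∣ ℚ.↥ (a ℚ.- b) ∣
      p∣ = ↦0⇒∣ (↦-+ a↦x (↦-neg b↦y)) (B.trans (B.+-congʳ { - y} x≋y) (B.-‿inverseʳ y))

-- From residues modulo 20 to the rational sums.

module ResidueClasses where
  open import Defs
  open Rings
  open CyclotomicPowers
  open IntegerSums
  open Rationals
  open import Algebra.Bundles using (CommutativeRing)
  open import Data.Nat as ℕ using (ℕ; zero; suc; _>_)
  import Data.Nat.Properties as ℕₚ
  import Data.Nat.DivMod as DivMod
  import Data.Nat.Divisibility as ℕ∣
  open import Data.Nat.Combinatorics using (_C_)
  open import Data.Nat.Primality using (Prime)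
  open import Data.Nat.Solver using (module +-*-Solver)
  open import Data.Integer as ℤ using (ℤ; +_; -[1+_]; -_; _^_)
  import Data.Integer.Properties as ℤₚ
  open import Data.Integer.Tactic.RingSolver using (solve-∀)
  open import Data.Rational as ℚ using (ℚ; 0ℚ)
  open import Data.Unit using (tt)
  open import Relation.Nullary using (¬_)
  open import Relation.Binary.PropositionalEquality as ≡ using (_≡_; cong; cong₂)

  [a+b*d]/d : ∀ a b d .{{_ : ℕ.NonZero d}} → (a ℕ.+ b ℕ.* d) ℕ./ d ≡ a ℕ./ d ℕ.+ b
  [a+b*d]/d a b d = ≡.trans (DivMod.+-distrib-/-∣ʳ a (ℕ∣.n∣m*n b)) (cong (a ℕ./ d ℕ.+_) (DivMod.m*n/n≡m b d))

  /4-period : ∀ r q → (r ℕ.+ q ℕ.* 20) ℕ./ 4 ≡ r ℕ./ 4 ℕ.+ q ℕ.* 5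
  /4-period r q = ≡.trans (cong (λ x → (r ℕ.+ x) ℕ./ 4) (≡.sym (ℕₚ.*-assoc q 5 4))) ([a+b*d]/d r (q ℕ.* 5) 4)

  /10-period : ∀ r q → (r ℕ.+ q ℕ.* 20 ℕ.+ 5) ℕ./ 10 ≡ (r ℕ.+ 5) ℕ./ 10 ℕ.+ q ℕ.* 2
  /10-period r q = ≡.trans (cong (ℕ._/ 10) shuffle) ([a+b*d]/d (r ℕ.+ 5) (q ℕ.* 2) 10)
    where
    shuffle : r ℕ.+ q ℕ.* 20 ℕ.+ 5 ≡ (r ℕ.+ 5) ℕ.+ q ℕ.* 2 ℕ.* 10
    shuffle = solve 2 (λ r q → r :+ q :* con 20 :+ con 5 := (r :+ con 5) :+ q :* con 2 :* con 10) ≡.refl r q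
      where
      open +-*-Solver

  ^-period-ℤ : ∀ x a q b → x ^ (a ℕ.+ q ℕ.* b) ≡ x ^ a ℤ.* (x ^ b) ^ q
  ^-period-ℤ x a q b = ≡.trans (ℤₚ.^-distribˡ-+-* x a (q ℕ.* b))
    (cong (x ^ a ℤ.*_) (≡.trans (cong (x ^_) (ℕₚ.*-comm q b)) (≡.sym (ℤₚ.^-*-assoc x b q))))

  -- Adding 20q raises the exponent of -1 by the even number 2q and that of 5 by 5q. The resulting
  -- factor matches the power of √5¹⁰ = 3125 on the cyclotomic side.
  leading-period : ∀ a r q → leading a (r ℕ.+ q ℕ.* 20) ≡ (+ 3125) ^ q ℤ.* leading a r
  leading-period a r q = begin
    a ℤ.* -[1+ 0 ] ^ ((r ℕ.+ q ℕ.* 20 ℕ.+ 5) ℕ./ 10) ℤ.* (+ 5) ^ ((r ℕ.+ q ℕ.* 20) ℕ./ 4)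
      ≡⟨ cong₂ (λ x y → a ℤ.* -[1+ 0 ] ^ x ℤ.* (+ 5) ^ y) (/10-period r q) (/4-period r q) ⟩
    a ℤ.* -[1+ 0 ] ^ (s ℕ.+ q ℕ.* 2) ℤ.* (+ 5) ^ (t ℕ.+ q ℕ.* 5)
      ≡⟨ cong₂ (λ x y → a ℤ.* x ℤ.* y) (^-period-ℤ -[1+ 0 ] s q 2) (^-period-ℤ (+ 5) t q 5) ⟩
    a ℤ.* (-[1+ 0 ] ^ s ℤ.* (+ 1) ^ q) ℤ.* ((+ 5) ^ t ℤ.* (+ 3125) ^ q)
      ≡⟨ cong (λ x → a ℤ.* (-[1+ 0 ] ^ s ℤ.* x) ℤ.* ((+ 5) ^ t ℤ.* (+ 3125) ^ q)) (ℤₚ.^-zeroˡ q) ⟩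
    a ℤ.* (-[1+ 0 ] ^ s ℤ.* + 1) ℤ.* ((+ 5) ^ t ℤ.* (+ 3125) ^ q)
      ≡⟨ rearrange a (-[1+ 0 ] ^ s) ((+ 5) ^ t) ((+ 3125) ^ q) ⟩
    (+ 3125) ^ q ℤ.* (a ℤ.* -[1+ 0 ] ^ s ℤ.* (+ 5) ^ t) ∎
    where
    open ≡.≡-Reasoning
    s = (r ℕ.+ 5) ℕ./ 10
    t = r ℕ./ 4
    rearrange : ∀ a b c d → a ℤ.* (b ℤ.* + 1) ℤ.* (c ℤ.* d) ≡ d ℤ.* (a ℤ.* b ℤ.* c)
    rearrange = solve-∀

  -- This is the source of (p - 1)/2 ≤ 2[p/4] + 1: a sum over k ≤ [p/4] reaches every even index up
  -- to (p - 1)/2.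
  residue-/4 : ∀ {r} → Residue r → r ℕ./ 2 ℕ.≤ suc (2 ℕ.* (r ℕ./ 4))
  residue-/4 r1 = ℕₚ.≤ᵇ⇒≤ _ _ tt
  residue-/4 r3 = ℕₚ.≤ᵇ⇒≤ _ _ tt
  residue-/4 r7 = ℕₚ.≤ᵇ⇒≤ _ _ tt
  residue-/4 r9 = ℕₚ.≤ᵇ⇒≤ _ _ tt
  residue-/4 r11 = ℕₚ.≤ᵇ⇒≤ _ _ tt
  residue-/4 r13 = ℕₚ.≤ᵇ⇒≤ _ _ tt
  residue-/4 r17 = ℕₚ.≤ᵇ⇒≤ _ _ tt
  residue-/4 r19 = ℕₚ.≤ᵇ⇒≤ _ _ tt

  module Sums (p : ℕ) (p-prime : Prime p) (p>5 : p > 5) {r : ℕ} (ρ : Residue r) (p%20≡r : p ℕ.% 20 ≡ r) where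
    open Modular p
    open PrimeModulus p p-prime
    open Reduction p p-prime
    open Cyclotomic p using (even-value₁; even-value₂)
    private module B = CommutativeRing ℤ/m

    q n N : ℕ
    q = p ℕ./ 20
    n = r ℕ./ 2 ℕ.+ q ℕ.* 10
    N = r ℕ./ 4 ℕ.+ q ℕ.* 5

    -- An inverse of 2 modulo p, since 2(n + 1) = p + 1.
    h : ℤ
    h = + suc n

    p≡r+20q : p ≡ r ℕ.+ q ℕ.* 20
    p≡r+20q = ≡.trans (DivMod.m≡m%n+[m/n]*n p 20) (cong (ℕ._+ q ℕ.* 20) p%20≡r)

    p≡1+2n : p ≡ suc (2 ℕ.* n)
    p≡1+2n = ≡.trans p≡r+20q (≡.trans (cong (ℕ._+ q ℕ.* 20) (residue-odd ρ)) (cong suc (2l+20q (r ℕ./ 2) q)))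

    p/4≡N : p ℕ./ 4 ≡ N
    p/4≡N = ≡.trans (cong (ℕ._/ 4) p≡r+20q) (/4-period r q)

    n≤1+2N : n ℕ.≤ suc (2 ℕ.* N)
    n≤1+2N = ℕₚ.≤-trans (ℕₚ.+-monoˡ-≤ (q ℕ.* 10) (residue-/4 ρ))
      (ℕₚ.≤-reflexive (cong suc (solve 2 (λ t q → con 2 :* t :+ q :* con 10 := con 2 :* (t :+ q :* con 5)) ≡.refl (r ℕ./ 4) q)))
      where
      open +-*-Solver

    2N<p : 2 ℕ.* N ℕ.< p
    2N<p = ≡.subst (2 ℕ.* N ℕ.<_) (≡.sym p≡1+2n) (ℕ.s≤s (ℕₚ.*-monoʳ-≤ 2
      (ℕₚ.+-mono-≤ (DivMod./-monoʳ-≤ r {4} {2} (ℕₚ.≤ᵇ⇒≤ 2 4 tt)) (ℕₚ.*-monoʳ-≤ q (ℕₚ.≤ᵇ⇒≤ 5 10 tt)))))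

    h*2≋1 : h ℤ.* + 2 ≋ + 1
    h*2≋1 = cong-mod (+ 1) (begin
      + suc n ℤ.* + 2            ≡⟨ double (+ n) ⟩
      + 1 ℤ.+ + 1 ℤ.* (+ 1 ℤ.+ + 2 ℤ.* + n)   ≡⟨ cong (λ x → + 1 ℤ.+ + 1 ℤ.* (+ 1 ℤ.+ x)) (ℤₚ.pos-* 2 n) ⟨
      + 1 ℤ.+ + 1 ℤ.* + suc (2 ℕ.* n)     ≡⟨ cong (λ x → + 1 ℤ.+ + 1 ℤ.* + x) p≡1+2n ⟨
      + 1 ℤ.+ + 1 ℤ.* + p        ∎)
      where
      open ≡.≡-Reasoning
      double : ∀ n → (+ 1 ℤ.+ n) ℤ.* + 2 ≡ + 1 ℤ.+ + 1 ℤ.* (+ 1 ℤ.+ + 2 ℤ.* n)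
      double = solve-∀

    [h*2]^k≋1 : ∀ k → (h ℤ.* + 2) ^ k ≋ + 1
    [h*2]^k≋1 zero = B.refl
    [h*2]^k≋1 (suc k) = B.*-cong h*2≋1 ([h*2]^k≋1 k)

    ∤-^ : ∀ {a} → ¬ (p ℕ∣.∣ a) → ∀ k → ¬ (p ℕ∣.∣ a ℕ.^ k)
    ∤-^ p∤a zero d = ℕₚ.<⇒≱ p>5 (ℕₚ.≤-trans (ℕ∣.∣⇒≤ d) (ℕₚ.≤ᵇ⇒≤ 1 5 tt))
    ∤-^ p∤a (suc k) = ∤-* p∤a (∤-^ p∤a k)

    p∤2 : ¬ (p ℕ∣.∣ 2)
    p∤2 d = ℕₚ.<⇒≱ p>5 (ℕₚ.≤-trans (ℕ∣.∣⇒≤ d) (ℕₚ.≤ᵇ⇒≤ 2 5 tt))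

    p∤5 : ¬ (p ℕ∣.∣ 5)
    p∤5 d = ℕₚ.<⇒≱ p>5 (ℕ∣.∣⇒≤ d)

    ∑-leading : ∀ g c K → ¬ (p ℕ∣.∣ ℤ.∣ K ∣) → K ℤ.* even (+ 16 ℤ.* g) n ≋ (+ 3125) ^ q ℤ.* (K ℤ.* leading c r) →
      ∑≤ (p ℕ./ 4) (λ k → + ((4 ℕ.* k) C (2 ℕ.* k)) ℤ.* g ^ k) ≋ leading c p
    ∑-leading g c K p∤K eq = begin
      ∑≤ (p ℕ./ 4) (λ k → + ((4 ℕ.* k) C (2 ℕ.* k)) ℤ.* g ^ k)
        ≡⟨ cong (λ N → ∑≤ N (λ k → + ((4 ℕ.* k) C (2 ℕ.* k)) ℤ.* g ^ k)) p/4≡N ⟩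
      ∑≤ N (λ k → + ((4 ℕ.* k) C (2 ℕ.* k)) ℤ.* g ^ k)   ≈⟨ ∑-C4k2k g n N p≡1+2n n≤1+2N 2N<p ⟩
      even (+ 16 ℤ.* g) n   ≈⟨ ≋-cancel K p∤K (B.trans eq (≋-reflexive (swap ((+ 3125) ^ q) K (leading c r)))) ⟩
      (+ 3125) ^ q ℤ.* leading c r      ≡⟨ leading-period c r q ⟨
      leading c (r ℕ.+ q ℕ.* 20)        ≡⟨ cong (leading c) p≡r+20q ⟨
      leading c p                       ∎
      where
      open import Relation.Binary.Reasoning.Setoid B.setoid
      swap : ∀ a b c → a ℤ.* (b ℤ.* c) ≡ b ℤ.* (a ℤ.* c)
      swap = solve-∀

    ∑-↦ : ∀ {a g} → a ↦ g → Σ≤ (p ℕ./ 4) (λ k → ℕ→ℚ ((4 ℕ.* k) C (2 ℕ.* k)) ℚ.* (a ^ℚ k)) ↦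
      ∑≤ (p ℕ./ 4) (λ k → + ((4 ℕ.* k) C (2 ℕ.* k)) ℤ.* g ^ k)
    ∑-↦ a↦g = ↦-∑ (λ k → ↦-* (↦-ℤ (+ ((4 ℕ.* k) C (2 ℕ.* k)))) (↦-^ a↦g k)) (p ℕ./ 4)

    -- Integers standing for -1/64 and -1/4 modulo p, with `h` in place of 1/2.
    g₁ g₂ : ℤ
    g₁ = - (h ^ 6)
    g₂ = - (h ^ 2)

    -h^k*2^k : ∀ k → -[1+ 0 ] ≋ - (h ^ k) ℤ.* (+ 2) ^ k
    -h^k*2^k k = B.sym (B.trans (≋-reflexive (≡.trans (≡.sym (ℤₚ.neg-distribˡ-* (h ^ k) ((+ 2) ^ k)))
      (cong -_ (≡.sym (^-distrib-* h (+ 2) k))))) (B.-‿cong ([h*2]^k≋1 k)))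

    -1/64↦g₁ : -[1+ 0 ] ℚ./ 64 ↦ g₁
    -1/64↦g₁ = ↦-/ -[1+ 0 ] 63 (∤-^ p∤2 6) (-h^k*2^k 6)

    -1/4↦g₂ : -[1+ 0 ] ℚ./ 4 ↦ g₂
    -1/4↦g₂ = ↦-/ -[1+ 0 ] 3 (∤-^ p∤2 2) (-h^k*2^k 2)

    -- Four of the six halves cancel against 16: 16(-h⁶) = (2h)⁴(-h²).
    16g₁≋-h² : + 16 ℤ.* g₁ ≋ h ℤ.* h ℤ.* -[1+ 0 ]
    16g₁≋-h² = B.trans (≋-reflexive (split h)) (B.trans (B.*-congʳ {h ℤ.* h ℤ.* -[1+ 0 ]} ([h*2]^k≋1 4)) (B.*-identityˡ _))
      where
      split : ∀ h → + 16 ℤ.* - (h ℤ.* (h ℤ.* (h ℤ.* (h ℤ.* (h ℤ.* (h ℤ.* + 1)))))) ≡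
        ((h ℤ.* + 2) ℤ.* ((h ℤ.* + 2) ℤ.* ((h ℤ.* + 2) ℤ.* ((h ℤ.* + 2) ℤ.* + 1)))) ℤ.* (h ℤ.* h ℤ.* -[1+ 0 ])
      split = solve-∀

    16g₂≋-4 : + 16 ℤ.* g₂ ≋ + 2 ℤ.* + 2 ℤ.* -[1+ 0 ]
    16g₂≋-4 = B.trans (≋-reflexive (split h)) (B.trans (B.*-congʳ { -[1+ 3 ]} ([h*2]^k≋1 2)) (B.*-identityˡ -[1+ 3 ]))
      where
      split : ∀ h → + 16 ℤ.* - (h ℤ.* (h ℤ.* + 1)) ≡ ((h ℤ.* + 2) ℤ.* ((h ℤ.* + 2) ℤ.* + 1)) ℤ.* -[1+ 3 ]
      split = solve-∀

    sum₁ : ∀ {b} → b ↦ leading (coefficient₁ ρ) p →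
      Σ≤ (p ℕ./ 4) (λ k → ℕ→ℚ ((4 ℕ.* k) C (2 ℕ.* k)) ℚ.* ((-[1+ 0 ] ℚ./ 64) ^ℚ k)) ≡ b [modℚ p ]
    sum₁ b↦ = ↦⇒modℚ (∑-↦ -1/64↦g₁) b↦
      (∑-leading g₁ (coefficient₁ ρ) (+ 1600) (∤-* {2 ℕ.^ 6} {5 ℕ.^ 2} (∤-^ p∤2 6) (∤-^ p∤5 2))
        (even-value₁ p-prime q ρ p≡r+20q h h*2≋1 16g₁≋-h²))

    sum₂ : ∀ {b} → b ↦ leading (coefficient₂ ρ) p →
      Σ≤ (p ℕ./ 4) (λ k → ℕ→ℚ ((4 ℕ.* k) C (2 ℕ.* k)) ℚ.* ((-[1+ 0 ] ℚ./ 4) ^ℚ k)) ≡ b [modℚ p ]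
    sum₂ b↦ = ↦⇒modℚ (∑-↦ -1/4↦g₂) b↦
      (∑-leading g₂ (coefficient₂ ρ) (+ 6400) (∤-* {2 ℕ.^ 8} {5 ℕ.^ 2} (∤-^ p∤2 8) (∤-^ p∤5 2))
        (even-value₂ p-prime q ρ p≡r+20q 16g₂≋-4))

    ↦-leading : ∀ a → ℤ→ℚ a ℚ.* (ℤ→ℚ -[1+ 0 ] ^ℚ ((p ℕ.+ 5) ℕ./ 10)) ℚ.* (ℕ→ℚ 5 ^ℚ (p ℕ./ 4)) ↦ leading a p
    ↦-leading a = ↦-* (↦-* (↦-ℤ a) (↦-^ (↦-ℤ -[1+ 0 ]) ((p ℕ.+ 5) ℕ./ 10))) (↦-^ (↦-ℤ (+ 5)) (p ℕ./ 4))

    -- For r ≥ 3 the equation between quotients says r ≡ 3 (mod 4), and it passes to p because 20 is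
    -- a multiple of 4.
    [p∸3]/4≡p/4 : (r ℕ.∸ 3) ℕ./ 4 ≡ r ℕ./ 4 → 3 ℕ.≤ r → (p ℕ.∸ 3) ℕ./ 4 ≡ p ℕ./ 4
    [p∸3]/4≡p/4 eq 3≤r = begin
      (p ℕ.∸ 3) ℕ./ 4                      ≡⟨ cong (λ x → (x ℕ.∸ 3) ℕ./ 4) p≡r+20q ⟩
      (r ℕ.+ q ℕ.* 20 ℕ.∸ 3) ℕ./ 4         ≡⟨ cong (ℕ._/ 4) (ℕₚ.+-∸-comm (q ℕ.* 20) 3≤r) ⟩
      (r ℕ.∸ 3 ℕ.+ q ℕ.* 20) ℕ./ 4         ≡⟨ /4-period (r ℕ.∸ 3) q ⟩
      (r ℕ.∸ 3) ℕ./ 4 ℕ.+ q ℕ.* 5          ≡⟨ cong (ℕ._+ q ℕ.* 5) eq ⟩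
      N                                    ≡⟨ p/4≡N ⟨
      p ℕ./ 4                              ∎
      where open ≡.≡-Reasoning

    ↦-leading-∸3 : ∀ a → (r ℕ.∸ 3) ℕ./ 4 ≡ r ℕ./ 4 → 3 ℕ.≤ r →
      ℤ→ℚ a ℚ.* (ℤ→ℚ -[1+ 0 ] ^ℚ ((p ℕ.+ 5) ℕ./ 10)) ℚ.* (ℕ→ℚ 5 ^ℚ ((p ℕ.∸ 3) ℕ./ 4)) ↦ leading a p
    ↦-leading-∸3 a eq 3≤r = ≡.subst
      (λ e → ℤ→ℚ a ℚ.* (ℤ→ℚ -[1+ 0 ] ^ℚ ((p ℕ.+ 5) ℕ./ 10)) ℚ.* (ℕ→ℚ 5 ^ℚ e) ↦ leading a p)
      (≡.sym ([p∸3]/4≡p/4 eq 3≤r)) (↦-leading a)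

    ↦-leading-1 : ℤ→ℚ -[1+ 0 ] ^ℚ ((p ℕ.+ 5) ℕ./ 10) ℚ.* (ℕ→ℚ 5 ^ℚ (p ℕ./ 4)) ↦ leading (+ 1) p
    ↦-leading-1 = ≡.subst (λ x → ℤ→ℚ -[1+ 0 ] ^ℚ ((p ℕ.+ 5) ℕ./ 10) ℚ.* (ℕ→ℚ 5 ^ℚ (p ℕ./ 4)) ↦ x)
      (cong (ℤ._* (+ 5) ^ (p ℕ./ 4)) (≡.sym (ℤₚ.*-identityˡ (-[1+ 0 ] ^ ((p ℕ.+ 5) ℕ./ 10)))))
      (↦-* (↦-^ (↦-ℤ -[1+ 0 ]) ((p ℕ.+ 5) ℕ./ 10)) (↦-^ (↦-ℤ (+ 5)) (p ℕ./ 4)))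

    ↦-leading-0 : 0ℚ ↦ leading (+ 0) p
    ↦-leading-0 = ≡.subst (0ℚ ↦_) (zero-leading (-[1+ 0 ] ^ ((p ℕ.+ 5) ℕ./ 10)) ((+ 5) ^ (p ℕ./ 4))) (↦-ℤ (+ 0))
      where
      zero-leading : ∀ x y → + 0 ≡ + 0 ℤ.* x ℤ.* y
      zero-leading = solve-∀

open import Defs
open import Data.Nat using (ℕ; _+_; _∸_; _/_; _%_; _>_) renaming (_*_ to _*ℕ_)
open import Data.Nat.Primality using (Prime)
open import Data.Nat.Combinatorics using (_C_)
open import Data.Integer using (+_; -[1+_])
open import Data.Rational using (ℚ; _*_; 0ℚ)
open import Data.Sum using (_⊎_)
open import Data.Product using (_×_)
open import Relation.Binary.PropositionalEquality using (_≡_)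
open import Data.Nat.Properties using (≤ᵇ⇒≤)
open import Data.Product using (_,_)
open import Data.Sum using (inj₁; inj₂)
open import Data.Unit using (tt)
open import Relation.Binary.PropositionalEquality using (refl)
open CyclotomicPowers using (Residue; r1; r3; r7; r9; r11; r13; r17; r19)
open ResidueClasses using (module Sums)

theorem2p5 : (p : ℕ) → Prime p → p > 5 →
    ((p % 20 ≡ 1 ⊎ p % 20 ≡ 3 ⊎ p % 20 ≡ 7 ⊎ p % 20 ≡ 9 →
    Σ≤ (p / 4) (λ k → ℕ→ℚ ((4 *ℕ k) C (2 *ℕ k)) * ((-[1+ 0 ] Data.Rational./ 64) ^ℚ k))
    ≡ ℤ→ℚ -[1+ 0 ] ^ℚ ((p + 5) / 10) * (ℕ→ℚ 5 ^ℚ (p / 4)) [modℚ p ])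
    × (p % 20 ≡ 11 ⊎ p % 20 ≡ 19 →
    Σ≤ (p / 4) (λ k → ℕ→ℚ ((4 *ℕ k) C (2 *ℕ k)) * ((-[1+ 0 ] Data.Rational./ 64) ^ℚ k))
    ≡ ℕ→ℚ 2 * (ℤ→ℚ -[1+ 0 ] ^ℚ ((p + 5) / 10)) * (ℕ→ℚ 5 ^ℚ ((p ∸ 3) / 4)) [modℚ p ])
    × (p % 20 ≡ 13 ⊎ p % 20 ≡ 17 →
    Σ≤ (p / 4) (λ k → ℕ→ℚ ((4 *ℕ k) C (2 *ℕ k)) * ((-[1+ 0 ] Data.Rational./ 64) ^ℚ k))
    ≡ 0ℚ [modℚ p ]))
    ×
    ((p % 20 ≡ 1 ⊎ p % 20 ≡ 9 ⊎ p % 20 ≡ 11 ⊎ p % 20 ≡ 19 →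
    Σ≤ (p / 4) (λ k → ℕ→ℚ ((4 *ℕ k) C (2 *ℕ k)) * ((-[1+ 0 ] Data.Rational./ 4) ^ℚ k))
    ≡ ℤ→ℚ -[1+ 0 ] ^ℚ ((p + 5) / 10) * (ℕ→ℚ 5 ^ℚ (p / 4)) [modℚ p ])
    × (p % 20 ≡ 3 ⊎ p % 20 ≡ 7 →
    Σ≤ (p / 4) (λ k → ℕ→ℚ ((4 *ℕ k) C (2 *ℕ k)) * ((-[1+ 0 ] Data.Rational./ 4) ^ℚ k))
    ≡ ℤ→ℚ -[1+ 1 ] * (ℤ→ℚ -[1+ 0 ] ^ℚ ((p + 5) / 10)) * (ℕ→ℚ 5 ^ℚ ((p ∸ 3) / 4)) [modℚ p ])
    × (p % 20 ≡ 13 ⊎ p % 20 ≡ 17 →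
    Σ≤ (p / 4) (λ k → ℕ→ℚ ((4 *ℕ k) C (2 *ℕ k)) * ((-[1+ 0 ] Data.Rational./ 4) ^ℚ k))
    ≡ 0ℚ [modℚ p ]))
theorem2p5 p p-prime p>5 =
  ( (λ { (inj₁ e) → S.sum₁ r1 e (S.↦-leading-1 r1 e) ; (inj₂ (inj₁ e)) → S.sum₁ r3 e (S.↦-leading-1 r3 e)
       ; (inj₂ (inj₂ (inj₁ e))) → S.sum₁ r7 e (S.↦-leading-1 r7 e) ; (inj₂ (inj₂ (inj₂ e))) → S.sum₁ r9 e (S.↦-leading-1 r9 e) })
  , (λ { (inj₁ e) → S.sum₁ r11 e (S.↦-leading-∸3 r11 e (+ 2) refl (≤ᵇ⇒≤ _ _ tt))
       ; (inj₂ e) → S.sum₁ r19 e (S.↦-leading-∸3 r19 e (+ 2) refl (≤ᵇ⇒≤ _ _ tt)) })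
  , (λ { (inj₁ e) → S.sum₁ r13 e (S.↦-leading-0 r13 e) ; (inj₂ e) → S.sum₁ r17 e (S.↦-leading-0 r17 e) }) )
  , ( (λ { (inj₁ e) → S.sum₂ r1 e (S.↦-leading-1 r1 e) ; (inj₂ (inj₁ e)) → S.sum₂ r9 e (S.↦-leading-1 r9 e)
       ; (inj₂ (inj₂ (inj₁ e))) → S.sum₂ r11 e (S.↦-leading-1 r11 e) ; (inj₂ (inj₂ (inj₂ e))) → S.sum₂ r19 e (S.↦-leading-1 r19 e) })
  , (λ { (inj₁ e) → S.sum₂ r3 e (S.↦-leading-∸3 r3 e -[1+ 1 ] refl (≤ᵇ⇒≤ _ _ tt))
       ; (inj₂ e) → S.sum₂ r7 e (S.↦-leading-∸3 r7 e -[1+ 1 ] refl (≤ᵇ⇒≤ _ _ tt)) })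
  , (λ { (inj₁ e) → S.sum₂ r13 e (S.↦-leading-0 r13 e) ; (inj₂ e) → S.sum₂ r17 e (S.↦-leading-0 r17 e) }) )
  where
  module S {r} (ρ : Residue r) (e : p % 20 ≡ r) = Sums p p-prime p>5 ρ e
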